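{- Let $1\leq k\leq n$ and let $G$ be a graph on $n$ vertices with exactly $k$ connected components. Then $$F(G)\leq (k-1)+\sum_{i=1}^{n-k+1}\binom{n-k+1}{i}h_i,$$ with equality if and only if $G$ is isomorphic to $(k-1)K_1\cup K_{n-k+1}$.
   Context: All graphs are finite, simple and undirected. A connected subgraph of a graph $G=(V,E)$ is a graph $(V',E')$ with $\emptyset\neq V'\subseteq V$, $E'\subseteq E$, every edge of $E'$ having both endpoints in $V'$, and $(V',E')$ connected; distinct pairs $(V',E')$ are counted separately. The core index $F(G)$ is the number of connected subgraphs of $G$ (for a disconnected graph it is the sum of the core indices of its components). $h_i$ denotes the number of connected labeled graphs on $i$ labeled vertices. $K_m$ is the complete graph on $m$ vertices, $G_1\cup G_2$ is the disjoint union, and $mG$ is the disjoint union of $m$ copies of $G$. -}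

module Defs where

open import Data.Bool using (Bool; true; false; _∧_; _∨_; not; if_then_else_)
open import Data.Nat using (ℕ; zero; suc; _+_; _*_; _∸_; _<ᵇ_; _≤ᵇ_)
open import Data.Nat.Combinatorics using (_C_)
open import Data.Fin using (Fin; toℕ; _≟_)
open import Data.List using (List; []; _∷_; map; length; allFin; concatMap; _++_)
open import Data.Bool.ListAction using (all; any)
open import Data.Empty using (⊥-elim)
open import Relation.Nullary using (yes; no)
open import Relation.Binary.PropositionalEquality using (refl; cong; cong₂)
open import Data.Bool.Properties using (∧-comm)
open import Data.Product using (_×_; _,_)
open import Relation.Nullary using (⌊_⌋)
open import Relation.Binary.PropositionalEquality using (_≡_)
open import Function.Bundles using (_↔_; Inverse)

record Graph (n : ℕ) : Set where
  field
    adj    : Fin n → Fin n → Bool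
    adj-sym    : ∀ i j → adj i j ≡ adj j i
    adj-irrefl : ∀ i → adj i i ≡ false
open Graph public

record _≅_ {n : ℕ} (G H : Graph n) : Set where
  field
    bij      : Fin n ↔ Fin n
    preserve : ∀ i j → adj G i j ≡ adj H (Inverse.to bij i) (Inverse.to bij j)

count : {A : Set} → (A → Bool) → List A → ℕ
count p []       = 0
count p (x ∷ xs) = (if p x then 1 else 0) + count p xs

iter : {A : Set} → ℕ → (A → A) → A → A
iter zero    f a = a
iter (suc m) f a = f (iter m f a)

bools : ℕ → List (List Bool)
bools zero    = [] ∷ []
bools (suc m) = concatMap (λ bs → (false ∷ bs) ∷ (true ∷ bs) ∷ []) (bools m)

extend : {n : ℕ} → Bool → (Fin n → Bool) → (Fin (suc n) → Bool)
extend b f Fin.zero    = b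
extend b f (Fin.suc i) = f i

subsets : (n : ℕ) → List (Fin n → Bool)
subsets zero    = (λ ()) ∷ []
subsets (suc n) = concatMap (λ f → extend false f ∷ extend true f ∷ []) (subsets n)

pick : {A : Set} → List A → List Bool → List A
pick []       _            = []
pick (x ∷ xs) []           = []
pick (x ∷ xs) (false ∷ bs) = pick xs bs
pick (x ∷ xs) (true ∷ bs)  = x ∷ pick xs bs

eqF : {n : ℕ} → Fin n → Fin n → Bool
eqF i j = ⌊ i ≟ j ⌋

Edge : ℕ → Set
Edge n = Fin n × Fin n

step : {n : ℕ} → List (Edge n) → (Fin n → Bool) → (Fin n → Bool)
step E R v = R v ∨ any (λ { (a , b) → (R a ∧ eqF v b) ∨ (R b ∧ eqF v a) }) E

-- vertices reachable from u using edges of E (n rounds suffice on n vertices)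
reach : {n : ℕ} → List (Edge n) → Fin n → Fin n → Bool
reach {n} E u = iter n (step E) (eqF u)

connectedB : {n : ℕ} → (Fin n → Bool) → List (Edge n) → Bool
connectedB {n} V E =
  any (λ u → V u ∧ all (λ v → not (V v) ∨ reach E u v) (allFin n)) (allFin n)

insideB : {n : ℕ} → (Fin n → Bool) → List (Edge n) → Bool
insideB V E = all (λ { (a , b) → V a ∧ V b }) E

edges : {n : ℕ} → Graph n → List (Edge n)
edges {n} G =
  concatMap (λ i → concatMap (λ j → if (toℕ i <ᵇ toℕ j) ∧ adj G i j then (i , j) ∷ [] else [])
                                    (allFin n))
            (allFin n)

allPairs : (m : ℕ) → List (Edge m)
allPairs m =
  concatMap (λ i → concatMap (λ j → if toℕ i <ᵇ toℕ j then (i , j) ∷ [] else []) (allFin m))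
            (allFin m)

-- Core index F(G): number of pairs (V', E'), V' ⊆ V nonempty, E' ⊆ E(G)
-- with endpoints in V', and (V', E') connected.

F : {n : ℕ} → Graph n → ℕ
F {n} G =
  count (λ VS → insideB (proj₁' VS) (pick (edges G) (proj₂' VS))
                ∧ connectedB (proj₁' VS) (pick (edges G) (proj₂' VS)))
        (concatMap (λ V → map (λ s → (V , s)) (bools (length (edges G)))) (subsets n))
  where
    proj₁' : (Fin n → Bool) × List Bool → Fin n → Bool
    proj₁' (V , _) = V
    proj₂' : (Fin n → Bool) × List Bool → List Bool
    proj₂' (_ , s) = s

-- number of connected components of G: vertices that are the least
-- vertex of their component
components : {n : ℕ} → Graph n → ℕ
components {n} G =
  count (λ u → all (λ v → not (toℕ v <ᵇ toℕ u) ∨ not (reach (edges G) u v)) (allFin n))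
        (allFin n)

-- h m: number of connected labeled graphs on the vertex set Fin m
h : ℕ → ℕ
h m = count (λ s → connectedB (λ _ → true) (pick (allPairs m) s))
            (bools (length (allPairs m)))

sum1 : ℕ → (ℕ → ℕ) → ℕ
sum1 zero    f = 0
sum1 (suc m) f = sum1 m f + f (suc m)

-- The graph (k-1)K₁ ∪ K_{n-k+1} on Fin n: vertices 0..k-2 isolated,
-- vertices k-1..n-1 form a clique.

isoClique : (n k : ℕ) → Graph n
isoClique n k = record
  { adj    = A
  ; adj-sym    = symP
  ; adj-irrefl = irr
  }
  where
    eqF-sym : ∀ (i j : Fin n) → eqF i j ≡ eqF j i
    eqF-sym i j with i ≟ j | j ≟ i
    ... | yes _ | yes _ = refl
    ... | no  _ | no  _ = refl
    ... | yes refl | no ¬q = ⊥-elim (¬q refl)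
    ... | no ¬p | yes refl = ⊥-elim (¬p refl)
    A : Fin n → Fin n → Bool
    A i j = not (eqF i j) ∧ ((k ∸ 1) ≤ᵇ toℕ i) ∧ ((k ∸ 1) ≤ᵇ toℕ j)
    symP : ∀ i j → A i j ≡ A j i
    symP i j = cong₂ _∧_ (cong not (eqF-sym i j))
                        (∧-comm ((k ∸ 1) ≤ᵇ toℕ i) ((k ∸ 1) ≤ᵇ toℕ j))
    irr : ∀ i → A i i ≡ false
    irr i with i ≟ i
    ... | yes _ = refl
    ... | no ¬p = ⊥-elim (¬p refl)

{-# OPTIONS --safe #-}

-- Write s(V) for the number of connected edge sets spanning the vertex set V, so
-- F(G) = Σ_V s(V). Then s(V) ≤ h_|V|, with equality if G[V] is complete, and s(V) > 0
-- forces V into a single component. Let R be the set of the k component roots (least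
-- vertices) and write V = U ∪ A with U ∩ R = ∅, A ⊆ R. For U = ∅ the sets A contribute
-- at most k in total; for U ≠ ∅ only A = ∅ and A = {root of U} can contribute, hence at
-- most h_|U| + h_{|U|+1}. Summing over U ⊆ V(G) ∖ R gives (k-1) + Σ_W h_|W|, where W runs
-- over the subsets of an (n-k+1)-element set (all roots merged into one point).
-- In case of equality, U = {u,v} shows that the non-roots form a clique and U = {v} that
-- each of them is adjacent to a root, necessarily the same one for all.

module Submission where

open import Defs
open import Data.Bool using (Bool; true; false; T; T?; not; _∧_; _∨_; if_then_else_)
open import Data.Bool.ListAction using (all; any; and; or)
open import Data.Bool.Properties using (T-∧; T-∨; T-≡)
open import Data.Empty using (⊥-elim)
open import Data.Fin using (Fin; zero; suc; toℕ; fromℕ; punchIn; _≟_)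
open import Data.Fin.Permutation as Perm using (Permutation; _⟨$⟩ʳ_; _⟨$⟩ˡ_; lift₀; insert; insert-punchIn)
open import Data.Fin.Properties using (all?; ¬∀⟶∃¬; suc-injective; toℕ-injective; toℕ-fromℕ)
open import Data.Fin.Subset using (Subset; _∈_; _∉_; _⊆_; ∣_∣; Nonempty; ⊥; ⊤; ∁; _∪_; _-_; ⁅_⁆)
open import Data.Fin.Subset.Properties using (∣p∣≤n; ∣⁅x⁆∣≡1; ∣∁p∣≡n∸∣p∣; p⊂q⇒∣p∣<∣q∣; out⊆; in⊆in; drop-∷-⊆; x∈⁅x⁆; x∈⁅y⁆⇒x≡y; x∈p∪q⁻; x∈p∪q⁺; x∈∁p⇒x∉p; x∉p⇒x∈∁p; ∪-identityˡ; ∪-identityʳ; p─⊥≡p; p─q⊆p; x∈p∧x≢y⇒x∈p-y; nonempty?; _∈?_)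
open import Data.List as List using (List; []; _∷_; map; allFin; filterᵇ; concatMap; _++_; tabulate; length)
open import Data.List.Membership.Propositional using (find; lose) renaming (_∈_ to _∈ˡ_)
open import Data.List.Membership.Propositional.Properties using (∈-allFin; ∈-concatMap⁺; ∈-filter⁻; ∈-map⁺; ∈-map⁻)
open import Data.List.Properties using (concatMap-cong; concatMap-map; map-concatMap; map-∘; map-cong; map-tabulate; map-++; filter-++)
open import Data.List.Relation.Unary.All as All using ()
open import Data.List.Relation.Unary.All.Properties using (all⁺; all⁻)
open import Data.List.Relation.Unary.Any using (here; there)
open import Data.List.Relation.Unary.Any.Properties using (any⁺; any⁻)
open import Data.Nat using (ℕ; zero; suc; _+_; _*_; _∸_; _≤_; _<_; z≤n; s≤s; _<ᵇ_; _≤ᵇ_)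
open import Data.Nat.Combinatorics using (_C_; k>n⇒nCk≡0; nCk+nC[k+1]≡[n+1]C[k+1])
open import Data.Nat.ListAction using (sum)
open import Data.Nat.ListAction.Properties using (sum-++)
open import Data.Nat.Properties hiding (_≟_; suc-injective)
open import Data.Product as Product using (_×_; _,_; ∃; proj₁; proj₂; uncurry)
open import Data.Sum as Sum using (_⊎_; inj₁; inj₂; swap)
open import Data.Vec as Vec using ([]; _∷_; lookup; here; there)
open import Data.Vec.Properties using (lookup⇒[]=; []=⇒lookup; lookup∘tabulate; tabulate-cong)
open import Function using (_∘_; id)
open import Function.Bundles using (_⇔_; Equivalence; mk⇔)
open import Relation.Binary.Construct.Closure.ReflexiveTransitive using (Star; ε; _◅_; _◅◅_; gmap; reverse)
open import Relation.Binary.Definitions using (tri<; tri≈; tri>)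
open import Relation.Binary.PropositionalEquality
open import Relation.Nullary using (yes; no; ¬_)
open import Relation.Nullary.Decidable using (toWitness; fromWitness; toWitnessFalse; fromWitnessFalse; _→-dec_)
open import Algebra.Properties.CommutativeMonoid.Sum +-0-commutativeMonoid using (sum-permute) renaming (sum to ∑)
open import Algebra.Properties.CommutativeSemigroup +-commutativeSemigroup using (interchange)

open Equivalence using (to; from)

private
  variable
    n : ℕ
    A B : Set

-- Boolean predicates and subsets

T-ext : ∀ {a b} → (T a → T b) → (T b → T a) → a ≡ b
T-ext {false} {false} _ _ = refl
T-ext {false} {true}  _ g = ⊥-elim (g _)
T-ext {true}  {false} f _ = ⊥-elim (f _)
T-ext {true}  {true}  _ _ = refl

∈-tabulate⁺ : ∀ {f : Fin n → Bool} {i} → T (f i) → i ∈ Vec.tabulate f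
∈-tabulate⁺ {f = f} {i} t = lookup⇒[]= i _ (trans (lookup∘tabulate f i) (to T-≡ t))

∈-tabulate⁻ : ∀ {f : Fin n → Bool} {i} → i ∈ Vec.tabulate f → T (f i)
∈-tabulate⁻ {f = f} {i} m = from T-≡ (trans (sym (lookup∘tabulate f i)) ([]=⇒lookup m))

Nonempty⇒0<∣p∣ : (p : Subset n) → Nonempty p → 0 < ∣ p ∣
Nonempty⇒0<∣p∣ (true  ∷ p) _               = s≤s z≤n
Nonempty⇒0<∣p∣ (false ∷ p) (suc i , there m) = Nonempty⇒0<∣p∣ p (i , m)

-- Reachability

-- Edge lists store an edge in a single orientation, so adjacency has to accept both.
Link : List (Edge n) → Fin n → Fin n → Set
Link E a b = (a , b) ∈ˡ E ⊎ (b , a) ∈ˡ E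

Path : List (Edge n) → Fin n → Fin n → Set
Path E = Star (Link E)

Path-sym : ∀ {E : List (Edge n)} {u v} → Path E u v → Path E v u
Path-sym = reverse swap

Path-mono : ∀ {E E′ : List (Edge n)} → (∀ {e} → e ∈ˡ E → e ∈ˡ E′) →
            ∀ {u v} → Path E u v → Path E′ u v
Path-mono E⊆E′ = gmap id (Sum.map E⊆E′ E⊆E′)

step⁻ : ∀ (E : List (Edge n)) R v → T (step E R v) →
        T (R v) ⊎ ∃ λ a → T (R a) × Link E a v
step⁻ E R v t with to T-∨ t
... | inj₁ r = inj₁ r
... | inj₂ s with find (any⁻ _ E s)
... | (a , b) , e∈E , q with to (T-∨ {R a ∧ eqF v b}) q
... | inj₁ q₁ with ra , v≡b ← to (T-∧ {R a}) q₁ =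
  inj₂ (a , ra , inj₁ (subst (λ w → (a , w) ∈ˡ E) (sym (toWitness v≡b)) e∈E))
... | inj₂ q₂ with rb , v≡a ← to (T-∧ {R b}) q₂ =
  inj₂ (b , rb , inj₂ (subst (λ w → (w , b) ∈ˡ E) (sym (toWitness v≡a)) e∈E))

step-extensive : ∀ (E : List (Edge n)) R {v} → T (R v) → T (step E R v)
step-extensive E R r = from T-∨ (inj₁ r)

step-link : ∀ (E : List (Edge n)) R {a v} → T (R a) → Link E a v → T (step E R v)
step-link E R ra (inj₁ e) = from T-∨ (inj₂ (any⁺ _ (lose e
  (from T-∨ (inj₁ (from T-∧ (ra , fromWitness refl)))))))
step-link E R {a} {v} ra (inj₂ e) = from T-∨ (inj₂ (any⁺ _ (lose e
  (from (T-∨ {R v ∧ _}) (inj₂ (from T-∧ (ra , fromWitness refl)))))))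

step-mono : ∀ (E : List (Edge n)) R R′ → (∀ v → T (R v) → T (R′ v)) →
            ∀ v → T (step E R v) → T (step E R′ v)
step-mono E R R′ R⊆R′ v t with step⁻ E R v t
... | inj₁ r            = step-extensive E R′ (R⊆R′ v r)
... | inj₂ (a , ra , l) = step-link E R′ (R⊆R′ a ra) l

module _ (E : List (Edge n)) (u : Fin n) where

  private
    ball : ℕ → Fin n → Bool
    ball m = iter m (step E) (eqF u)

    ball⇒Path : ∀ m {v} → T (ball m v) → Path E u v
    ball⇒Path zero {v} t with refl ← toWitness {a? = u ≟ v} t = ε
    ball⇒Path (suc m) {v} t with step⁻ E (ball m) v t
    ... | inj₁ r            = ball⇒Path m r
    ... | inj₂ (a , ra , l) = ball⇒Path m ra ◅◅ (l ◅ ε)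

    centre∈ball : ∀ m → T (ball m u)
    centre∈ball zero    = fromWitness refl
    centre∈ball (suc m) = step-extensive E (ball m) (centre∈ball m)

    Stable : ℕ → Set
    Stable m = ∀ v → T (ball (suc m) v) → T (ball m v)

    -- Until it becomes stable, the ball gains a vertex in every round.
    stable-or-large : ∀ m → Stable m ⊎ m < ∣ Vec.tabulate (ball m) ∣
    stable-or-large zero = inj₂ (Nonempty⇒0<∣p∣ _ (u , ∈-tabulate⁺ (centre∈ball 0)))
    stable-or-large (suc m) with stable-or-large m
    ... | inj₁ st = inj₁ (step-mono E (ball (suc m)) (ball m) st)
    ... | inj₂ m< with all? (λ v → T? (ball (suc m) v) →-dec T? (ball m v))
    ... | yes st = inj₁ (step-mono E (ball (suc m)) (ball m) st)
    ... | no ¬st with ¬∀⟶∃¬ n _ (λ v → T? (ball (suc m) v) →-dec T? (ball m v)) ¬st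
    ... | v , ¬imp = inj₂ (≤-<-trans m< (p⊂q⇒∣p∣<∣q∣
      ( (λ i∈ → ∈-tabulate⁺ (step-extensive E (ball m) (∈-tabulate⁻ i∈)))
      , v , ∈-tabulate⁺ new , λ v∈ → ¬imp λ _ → ∈-tabulate⁻ v∈)))
      where
      new : T (ball (suc m) v)
      new with T? (ball (suc m) v)
      ... | yes t = t
      ... | no ¬t = ⊥-elim (¬imp (⊥-elim ∘ ¬t))

    -- If the ball were still growing up to round `n`, it would contain more than `n` vertices.
    stable : Stable n
    stable with stable-or-large n
    ... | inj₁ st = st
    ... | inj₂ n< = ⊥-elim (<⇒≱ n< (∣p∣≤n (Vec.tabulate (ball n))))

  reach⇒Path : ∀ {v} → T (reach E u v) → Path E u v
  reach⇒Path = ball⇒Path n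

  -- By stability the ball of radius `n` is closed under links, so a path that starts at the centre
  -- never leaves it.
  Path⇒reach : ∀ {v} → Path E u v → T (reach E u v)
  Path⇒reach = go (centre∈ball n)
    where
    go : ∀ {a v} → T (ball n a) → Path E a v → T (ball n v)
    go t ε       = t
    go t (l ◅ p) = go (stable _ (step-link E (ball n) t l)) p

-- The paths may leave `V`; that the edges stay inside `V` is imposed separately by `insideB`.
Connected : (Fin n → Bool) → List (Edge n) → Set
Connected V E = ∃ λ u → T (V u) × (∀ v → T (V v) → Path E u v)

T-implies⁻ : ∀ {a b} → T (not a ∨ b) → T a → T b
T-implies⁻ {true} t _ = t

T-implies⁺ : ∀ {a b} → (T a → T b) → T (not a ∨ b)
T-implies⁺ {true}  f = f _
T-implies⁺ {false} f = _

all-allFin⁻ : ∀ {p : Fin n → Bool} → T (all p (allFin n)) → ∀ i → T (p i)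
all-allFin⁻ t i = All.lookup (all⁺ _ _ t) (∈-allFin i)

all-allFin⁺ : ∀ {p : Fin n → Bool} → (∀ i → T (p i)) → T (all p (allFin n))
all-allFin⁺ {n} {p} f = all⁻ p {xs = allFin n} (All.tabulate (λ {i} _ → f i))

connectedB⇒Connected : ∀ {V : Fin n → Bool} {E} → T (connectedB V E) → Connected V E
connectedB⇒Connected {n} {V} {E} t with find (any⁻ _ (allFin n) t)
... | u , _ , q with to (T-∧ {V u}) q
... | vu , r = u , vu , λ v vv → reach⇒Path E u (T-implies⁻ (all-allFin⁻ r v) vv)

Connected⇒connectedB : ∀ {V : Fin n → Bool} {E} → Connected V E → T (connectedB V E)
Connected⇒connectedB {n} {V} {E} (u , vu , f) = any⁺ _ (lose (∈-allFin u)
  (from (T-∧ {V u}) (vu , all-allFin⁺ (λ v → T-implies⁺ (Path⇒reach E u ∘ f v)))))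

-- Counts as sums

⟦_⟧ : Bool → ℕ
⟦ b ⟧ = if b then 1 else 0

count≡sum : (p : A → Bool) → ∀ xs → count p xs ≡ sum (map (⟦_⟧ ∘ p) xs)
count≡sum p []       = refl
count≡sum p (x ∷ xs) = cong (⟦ p x ⟧ +_) (count≡sum p xs)

sum-concatMap : (f : B → ℕ) (g : A → List B) → ∀ xs →
                sum (map f (concatMap g xs)) ≡ sum (map (λ x → sum (map f (g x))) xs)
sum-concatMap f g []       = refl
sum-concatMap f g (x ∷ xs) = begin
  sum (map f (g x ++ concatMap g xs))                    ≡⟨ cong sum (map-++ f (g x) _) ⟩
  sum (map f (g x) ++ map f (concatMap g xs))            ≡⟨ sum-++ (map f (g x)) _ ⟩
  sum (map f (g x)) + sum (map f (concatMap g xs))       ≡⟨ cong (sum (map f (g x)) +_) (sum-concatMap f g xs) ⟩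
  sum (map f (g x)) + sum (map (λ x → sum (map f (g x))) xs) ∎
  where open ≡-Reasoning

-- Both `bools` and `subsets` grow by such a branching; the two sums collect the choices without and
-- with the new element.
sum-branch : (f : B → ℕ) (g₁ g₂ : A → B) → ∀ xs →
             sum (map f (concatMap (λ x → g₁ x ∷ g₂ x ∷ []) xs))
             ≡ sum (map (f ∘ g₁) xs) + sum (map (f ∘ g₂) xs)
sum-branch f g₁ g₂ []       = refl
sum-branch f g₁ g₂ (x ∷ xs) rewrite sum-branch f g₁ g₂ xs =
  trans (sym (+-assoc (f (g₁ x)) _ _))
        (interchange (f (g₁ x)) (f (g₂ x)) (sum (map (f ∘ g₁) xs)) _)

-- Counting sublists

-- Recursion on the list itself replaces the bit masks of `bools`: the first summand omits `x`, the
-- second contains it.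
countSublists : (List A → Bool) → List A → ℕ
countSublists P []       = ⟦ P [] ⟧
countSublists P (x ∷ xs) = countSublists P xs + countSublists (P ∘ (x ∷_)) xs

count-pick : (P : List A → Bool) → ∀ xs →
             count (P ∘ pick xs) (bools (length xs)) ≡ countSublists P xs
count-pick P xs = trans (count≡sum (P ∘ pick xs) (bools (length xs))) (go P xs)
  where
  go : (P : List A → Bool) → ∀ xs →
       sum (map (⟦_⟧ ∘ P ∘ pick xs) (bools (length xs))) ≡ countSublists P xs
  go P []       = +-identityʳ _
  go P (x ∷ xs) = trans
    (sum-branch (⟦_⟧ ∘ P ∘ pick (x ∷ xs)) (false ∷_) (true ∷_) (bools (length xs)))
    (cong₂ _+_ (go P xs) (go (P ∘ (x ∷_)) xs))

countSublists-cong : {P Q : List A → Bool} → P ≗ Q → ∀ xs →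
                     countSublists P xs ≡ countSublists Q xs
countSublists-cong P≗Q []       = cong ⟦_⟧ (P≗Q [])
countSublists-cong P≗Q (x ∷ xs) =
  cong₂ _+_ (countSublists-cong P≗Q xs) (countSublists-cong (P≗Q ∘ (x ∷_)) xs)

countSublists-map : (P : List B → Bool) (f : A → B) → ∀ xs →
                    countSublists P (map f xs) ≡ countSublists (P ∘ map f) xs
countSublists-map P f []       = refl
countSublists-map P f (x ∷ xs) =
  cong₂ _+_ (countSublists-map P f xs) (countSublists-map (P ∘ (f x ∷_)) f xs)

countSublists-filter-≤ : (P : List A → Bool) (q : A → Bool) → ∀ xs →
                         countSublists P (filterᵇ q xs) ≤ countSublists P xs
countSublists-filter-≤ P q []       = ≤-refl
countSublists-filter-≤ P q (x ∷ xs) with q x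
... | true  = +-mono-≤ (countSublists-filter-≤ P q xs) (countSublists-filter-≤ (P ∘ (x ∷_)) q xs)
... | false = ≤-trans (countSublists-filter-≤ P q xs) (m≤m+n _ _)

countSublists-false : ∀ (xs : List A) → countSublists (λ _ → false) xs ≡ 0
countSublists-false []       = refl
countSublists-false (x ∷ xs) = cong₂ _+_ (countSublists-false xs) (countSublists-false xs)

-- A sublist with all entries satisfying `q` is a sublist of the filtered list. This turns the test
-- `insideB` into a restriction of the available edges.
countSublists-all : (q : A → Bool) (P : List A → Bool) → ∀ xs →
                    countSublists (λ ys → all q ys ∧ P ys) xs ≡ countSublists P (filterᵇ q xs)
countSublists-all q P []       = refl
countSublists-all q P (x ∷ xs) with q x
... | true  = cong₂ _+_ (countSublists-all q P xs) (countSublists-all q (P ∘ (x ∷_)) xs)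
... | false = trans (cong₂ _+_ (countSublists-all q P xs) (countSublists-false xs)) (+-identityʳ _)

countSublists-witness : (P : List A → Bool) → ∀ xs → 0 < countSublists P xs →
                        ∃ λ ys → T (P ys) × (∀ {y} → y ∈ˡ ys → y ∈ˡ xs)
countSublists-witness P [] 0< with P [] in eq
... | true = [] , from T-≡ eq , id
countSublists-witness P (x ∷ xs) 0< with countSublists P xs in eq
... | suc _ with ys , Pys , ys⊆ ← countSublists-witness P xs (subst (0 <_) (sym eq) (s≤s z≤n)) =
  ys , Pys , λ m → there (ys⊆ m)
... | zero with countSublists-witness (P ∘ (x ∷_)) xs 0<
... | ys , Pys , ys⊆ = x ∷ ys , Pys , λ { (here e) → here e ; (there m) → there (ys⊆ m) }

-- Lists of vertex pairs

filterᵇ-++ : (p : A → Bool) → ∀ xs ys → filterᵇ p (xs ++ ys) ≡ filterᵇ p xs ++ filterᵇ p ys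
filterᵇ-++ p = filter-++ (T? ∘ p)

filterᵇ-concatMap : (p : B → Bool) (f : A → List B) → ∀ xs →
                    filterᵇ p (concatMap f xs) ≡ concatMap (filterᵇ p ∘ f) xs
filterᵇ-concatMap p f []       = refl
filterᵇ-concatMap p f (x ∷ xs) =
  trans (filterᵇ-++ p (f x) _) (cong (filterᵇ p (f x) ++_) (filterᵇ-concatMap p f xs))

filterᵇ-map : (p : B → Bool) (f : A → B) → ∀ xs → filterᵇ p (map f xs) ≡ map f (filterᵇ (p ∘ f) xs)
filterᵇ-map p f [] = refl
filterᵇ-map p f (x ∷ xs) with p (f x)
... | true  = cong (f x ∷_) (filterᵇ-map p f xs)
... | false = filterᵇ-map p f xs

filterᵇ-comm : (p q : A → Bool) → ∀ xs → filterᵇ p (filterᵇ q xs) ≡ filterᵇ q (filterᵇ p xs)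
filterᵇ-comm p q [] = refl
filterᵇ-comm p q (x ∷ xs) with q x in qx | p x in px
... | true  | true  rewrite px | qx = cong (x ∷_) (filterᵇ-comm p q xs)
... | true  | false rewrite px = filterᵇ-comm p q xs
... | false | true  rewrite qx = filterᵇ-comm p q xs
... | false | false = filterᵇ-comm p q xs

-- Pairs are taken by position in the list, without comparing numbers as `allPairs` does, so that
-- they commute with `map` and `filterᵇ`.
pairs : List A → List (A × A)
pairs []       = []
pairs (x ∷ xs) = map (x ,_) xs ++ pairs xs

pairs-map : (f : A → B) → ∀ xs → pairs (map f xs) ≡ map (Product.map f f) (pairs xs)
pairs-map f []       = refl
pairs-map f (x ∷ xs) = begin
  map (f x ,_) (map f xs) ++ pairs (map f xs)
    ≡⟨ cong₂ _++_ (trans (sym (map-∘ xs)) (map-∘ xs)) (pairs-map f xs) ⟩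
  map (Product.map f f) (map (x ,_) xs) ++ map (Product.map f f) (pairs xs)
    ≡⟨ map-++ (Product.map f f) (map (x ,_) xs) (pairs xs) ⟨
  map (Product.map f f) (map (x ,_) xs ++ pairs xs) ∎
  where open ≡-Reasoning

both : (A → Bool) → A × A → Bool
both p (a , b) = p a ∧ p b

filterᵇ-none : ∀ (xs : List A) → filterᵇ (λ _ → false) xs ≡ []
filterᵇ-none []       = refl
filterᵇ-none (x ∷ xs) = filterᵇ-none xs

filterᵇ-pairs : (p : A → Bool) → ∀ xs → filterᵇ (both p) (pairs xs) ≡ pairs (filterᵇ p xs)
filterᵇ-pairs p [] = refl
filterᵇ-pairs p (x ∷ xs) = trans (filterᵇ-++ (both p) (map (x ,_) xs) (pairs xs))
  (trans (cong₂ _++_ (filterᵇ-map (both p) (x ,_) xs) (filterᵇ-pairs p xs)) row)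
  where
  row : map (x ,_) (filterᵇ (λ y → p x ∧ p y) xs) ++ pairs (filterᵇ p xs) ≡ pairs (filterᵇ p (x ∷ xs))
  row with p x
  ... | true  = refl
  ... | false rewrite filterᵇ-none xs = refl

-- The body of `edges` for a bare relation; `edges G` is `edgesOf (adj G)` by computation.
edgesOf : (Fin n → Fin n → Bool) → List (Edge n)
edgesOf {n} q = concatMap (λ i → concatMap (λ j → if (toℕ i <ᵇ toℕ j) ∧ q i j then (i , j) ∷ [] else [])
                                          (allFin n)) (allFin n)

edgesOf-filter : (q : Fin n → Fin n → Bool) → edgesOf q ≡ filterᵇ (uncurry q) (allPairs n)
edgesOf-filter {n} q = sym (trans (filterᵇ-concatMap _ _ (allFin n)) (concatMap-cong (λ i →
    trans (filterᵇ-concatMap _ _ (allFin n)) (concatMap-cong (cell i) (allFin n))) (allFin n)))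
  where
  cell : ∀ i j → filterᵇ (uncurry q) (if toℕ i <ᵇ toℕ j then (i , j) ∷ [] else [])
         ≡ (if (toℕ i <ᵇ toℕ j) ∧ q i j then (i , j) ∷ [] else [])
  cell i j with toℕ i <ᵇ toℕ j
  ... | false = refl
  ... | true with q i j
  ... | true  = refl
  ... | false = refl

filterᵇ-allPairs-complete : (q : Fin n → Fin n → Bool) → (∀ {i j} → i ≢ j → T (q i j)) →
                            filterᵇ (uncurry q) (allPairs n) ≡ allPairs n
filterᵇ-allPairs-complete {n} q complete = trans (sym (edgesOf-filter q))
  (concatMap-cong (λ i → concatMap-cong (cell i) (allFin n)) (allFin n))
  where
  cell : ∀ i j → (if (toℕ i <ᵇ toℕ j) ∧ q i j then (i , j) ∷ [] else [])
         ≡ (if toℕ i <ᵇ toℕ j then (i , j) ∷ [] else [])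
  cell i j with toℕ i <ᵇ toℕ j in eq
  ... | false = refl
  -- The test for `toℕ i` below `toℕ j` succeeded, so `i` and `j` differ.
  ... | true rewrite to T-≡ (complete {i} {j} (λ { refl → <-irrefl {toℕ i} refl (<ᵇ⇒< _ _ (from T-≡ eq)) })) = refl

tabulate-suc : ∀ n → tabulate {n = n} Fin.suc ≡ map Fin.suc (allFin n)
tabulate-suc n = sym (map-tabulate id Fin.suc)

concatMap-singleton : (f : A → B) → ∀ xs → concatMap (λ x → f x ∷ []) xs ≡ map f xs
concatMap-singleton f []       = refl
concatMap-singleton f (x ∷ xs) = cong (f x ∷_) (concatMap-singleton f xs)

-- The row of `zero` pairs it with every successor; the other rows are the pairs of `Fin n` with
-- both entries shifted.
allPairs≡pairs : ∀ n → allPairs n ≡ pairs (allFin n)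
allPairs≡pairs zero    = refl
allPairs≡pairs (suc n) = cong₂ _++_ firstRow otherRows
  where
  open ≡-Reasoning
  cell : ∀ {m} → Fin m → Fin m → List (Edge m)
  cell i j = if toℕ i <ᵇ toℕ j then (i , j) ∷ [] else []

  firstRow : concatMap (cell {suc n} zero) (tabulate suc) ≡ map (zero ,_) (tabulate suc)
  firstRow = begin
    concatMap (cell zero) (tabulate suc)          ≡⟨ cong (concatMap (cell zero)) (tabulate-suc n) ⟩
    concatMap (cell zero) (map suc (allFin n))    ≡⟨ concatMap-map (cell zero) suc (allFin n) ⟩
    concatMap (cell zero ∘ suc) (allFin n)        ≡⟨ concatMap-singleton (λ j → zero , suc j) (allFin n) ⟩
    map (λ j → zero , suc j) (allFin n)           ≡⟨ map-∘ (allFin n) ⟩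
    map (zero ,_) (map suc (allFin n))            ≡⟨ cong (map (zero ,_)) (tabulate-suc n) ⟨
    map (zero ,_) (tabulate suc)                  ∎

  shift : ∀ i j → cell {suc n} (suc i) (suc j) ≡ map (Product.map suc suc) (cell i j)
  shift i j with toℕ i <ᵇ toℕ j
  ... | true  = refl
  ... | false = refl

  row : ∀ i → concatMap (cell (suc i)) (tabulate suc) ≡ map (Product.map suc suc) (concatMap (cell i) (allFin n))
  row i = begin
    concatMap (cell (suc i)) (tabulate suc)            ≡⟨ cong (concatMap (cell (suc i))) (tabulate-suc n) ⟩
    concatMap (cell (suc i)) (map suc (allFin n))      ≡⟨ concatMap-map (cell (suc i)) suc (allFin n) ⟩
    concatMap (cell (suc i) ∘ suc) (allFin n)          ≡⟨ concatMap-cong (shift i) (allFin n) ⟩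
    concatMap (map (Product.map suc suc) ∘ cell i) (allFin n) ≡⟨ map-concatMap (Product.map suc suc) (cell i) (allFin n) ⟨
    map (Product.map suc suc) (concatMap (cell i) (allFin n)) ∎

  otherRows : concatMap (λ i → concatMap (cell i) (allFin (suc n))) (tabulate suc) ≡ pairs (tabulate suc)
  otherRows = begin
    concatMap (λ i → concatMap (cell i) (allFin (suc n))) (tabulate suc)
      ≡⟨ cong (concatMap _) (tabulate-suc n) ⟩
    concatMap (λ i → concatMap (cell i) (allFin (suc n))) (map suc (allFin n))
      ≡⟨ concatMap-map _ suc (allFin n) ⟩
    -- The column of `zero` disappears by computation, since no number lies below 0.
    concatMap (λ i → concatMap (cell (suc i)) (tabulate suc)) (allFin n)
      ≡⟨ concatMap-cong row (allFin n) ⟩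
    concatMap (λ i → map (Product.map suc suc) (concatMap (cell i) (allFin n))) (allFin n)
      ≡⟨ map-concatMap (Product.map suc suc) _ (allFin n) ⟨
    map (Product.map suc suc) (allPairs n)
      ≡⟨ cong (map _) (allPairs≡pairs n) ⟩
    map (Product.map suc suc) (pairs (allFin n))
      ≡⟨ pairs-map suc (allFin n) ⟨
    pairs (map suc (allFin n))
      ≡⟨ cong pairs (tabulate-suc n) ⟨
    pairs (tabulate suc) ∎

-- The connected subgraphs with a given vertex set

-- The increasing bijection from `Fin ∣ V ∣` onto `V`, used to compare subgraphs on `V` with the
-- labeled graphs counted by `h`.
enum : (V : Subset n) → Fin ∣ V ∣ → Fin n
enum (true  ∷ V) zero    = zero
enum (true  ∷ V) (suc i) = suc (enum V i)
enum (false ∷ V) i       = suc (enum V i)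

enum-injective : (V : Subset n) → ∀ {i j} → enum V i ≡ enum V j → i ≡ j
enum-injective (true  ∷ V) {zero}  {zero}  _  = refl
enum-injective (true  ∷ V) {suc i} {suc j} eq = cong suc (enum-injective V (suc-injective eq))
enum-injective (false ∷ V) eq = enum-injective V (suc-injective eq)

enum-∈ : (V : Subset n) → ∀ i → T (lookup V (enum V i))
enum-∈ (true  ∷ V) zero    = _
enum-∈ (true  ∷ V) (suc i) = enum-∈ V i
enum-∈ (false ∷ V) i       = enum-∈ V i

enum-surjective : (V : Subset n) → ∀ v → T (lookup V v) → ∃ λ i → enum V i ≡ v
enum-surjective (true  ∷ V) zero    _ = zero , refl
enum-surjective (true  ∷ V) (suc v) t = Product.map suc (cong suc) (enum-surjective V v t)
enum-surjective (false ∷ V) (suc v) t = Product.map id (cong suc) (enum-surjective V v t)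

filterᵇ-allFin : (V : Subset n) → filterᵇ (lookup V) (allFin n) ≡ map (enum V) (allFin ∣ V ∣)
filterᵇ-allFin []      = refl
filterᵇ-allFin {suc n} (b ∷ V) = helper b
  where
  open ≡-Reasoning
  tail : ∀ b → filterᵇ (lookup (b ∷ V)) (tabulate suc) ≡ map (suc ∘ enum V) (allFin ∣ V ∣)
  tail b = begin
    filterᵇ (lookup (b ∷ V)) (tabulate suc)         ≡⟨ cong (filterᵇ (lookup (b ∷ V))) (tabulate-suc n) ⟩
    filterᵇ (lookup (b ∷ V)) (map suc (allFin n))   ≡⟨ filterᵇ-map (lookup (b ∷ V)) suc (allFin n) ⟩
    map suc (filterᵇ (lookup V) (allFin n))         ≡⟨ cong (map suc) (filterᵇ-allFin V) ⟩
    map suc (map (enum V) (allFin ∣ V ∣))           ≡⟨ map-∘ (allFin ∣ V ∣) ⟨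
    map (suc ∘ enum V) (allFin ∣ V ∣)               ∎
  helper : ∀ b → filterᵇ (lookup (b ∷ V)) (allFin (suc n)) ≡ map (enum (b ∷ V)) (allFin ∣ b ∷ V ∣)
  helper false = tail false
  helper true  = cong (zero ∷_) (begin
    filterᵇ (lookup (true ∷ V)) (tabulate suc)      ≡⟨ tail true ⟩
    map (suc ∘ enum V) (allFin ∣ V ∣)               ≡⟨ map-∘ (allFin ∣ V ∣) ⟩
    map (enum (true ∷ V)) (map suc (allFin ∣ V ∣))  ≡⟨ cong (map _) (tabulate-suc ∣ V ∣) ⟨
    map (enum (true ∷ V)) (tabulate suc)            ∎)

-- Since `enum V` is increasing, the pairs inside `V` are the images of the pairs of `Fin ∣ V ∣`,
-- even in the same order.
filterᵇ-allPairs : (V : Subset n) →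
  filterᵇ (both (lookup V)) (allPairs n) ≡ map (Product.map (enum V) (enum V)) (allPairs ∣ V ∣)
filterᵇ-allPairs {n} V = begin
  filterᵇ (both (lookup V)) (allPairs n)          ≡⟨ cong (filterᵇ _) (allPairs≡pairs n) ⟩
  filterᵇ (both (lookup V)) (pairs (allFin n))    ≡⟨ filterᵇ-pairs (lookup V) (allFin n) ⟩
  pairs (filterᵇ (lookup V) (allFin n))           ≡⟨ cong pairs (filterᵇ-allFin V) ⟩
  pairs (map (enum V) (allFin ∣ V ∣))             ≡⟨ pairs-map (enum V) (allFin ∣ V ∣) ⟩
  map (Product.map (enum V) (enum V)) (pairs (allFin ∣ V ∣)) ≡⟨ cong (map _) (allPairs≡pairs ∣ V ∣) ⟨
  map (Product.map (enum V) (enum V)) (allPairs ∣ V ∣) ∎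
  where open ≡-Reasoning

module _ {m n} (f : Fin m → Fin n) (f-injective : ∀ {i j} → f i ≡ f j → i ≡ j) where

  Link-map⁻ : ∀ {E : List (Edge m)} {a w} → Link (map (Product.map f f) E) (f a) w →
              ∃ λ b → f b ≡ w × Link E a b
  Link-map⁻ (inj₁ l) with ∈-map⁻ (Product.map f f) l
  ... | (a′ , b) , e∈E , eq with refl ← f-injective (cong proj₁ eq) = b , sym (cong proj₂ eq) , inj₁ e∈E
  Link-map⁻ (inj₂ l) with ∈-map⁻ (Product.map f f) l
  ... | (b , a′) , e∈E , eq with refl ← f-injective (cong proj₂ eq) = b , sym (cong proj₁ eq) , inj₂ e∈E

  -- By injectivity each link at `f a` comes from a link at `a`, so a path that starts in the image
  -- of `f` stays there and lifts.
  Path-map⁻ : ∀ {E : List (Edge m)} {a b} → Path (map (Product.map f f) E) (f a) (f b) → Path E a b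
  Path-map⁻ {E} p = go p refl
    where
    -- The endpoint is a variable with an equation, so that matching on `ε` need not unify `f a`
    -- with `f b`.
    go : ∀ {a b w} → Path (map (Product.map f f) E) (f a) w → w ≡ f b → Path E a b
    go {a} ε eq = subst (Path E a) (f-injective eq) ε
    go (l ◅ p) eq with Link-map⁻ l
    ... | b , refl , l′ = l′ ◅ go p eq

Path-map⁺ : ∀ {m n} (f : Fin m → Fin n) {E : List (Edge m)} {a b} →
            Path E a b → Path (map (Product.map f f) E) (f a) (f b)
Path-map⁺ f = gmap f (Sum.map (∈-map⁺ (Product.map f f)) (∈-map⁺ (Product.map f f)))

connectedB-enum : (V : Subset n) (E : List (Edge ∣ V ∣)) →
  connectedB (lookup V) (map (Product.map (enum V) (enum V)) E) ≡ connectedB (λ _ → true) E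
connectedB-enum V E = T-ext
  (λ t → Connected⇒connectedB (pull (connectedB⇒Connected t)))
  (λ t → Connected⇒connectedB (push (connectedB⇒Connected t)))
  where
  pull : Connected (lookup V) (map (Product.map (enum V) (enum V)) E) → Connected (λ _ → true) E
  pull (u , u∈V , paths) with enum-surjective V u u∈V
  ... | i , refl = i , _ , λ j _ → Path-map⁻ (enum V) (enum-injective V) (paths (enum V j) (enum-∈ V j))
  push : Connected (λ _ → true) E → Connected (lookup V) (map (Product.map (enum V) (enum V)) E)
  push (i , _ , paths) = enum V i , enum-∈ V i , λ v v∈V → helper v (enum-surjective V v v∈V)
    where
    helper : ∀ v → (∃ λ j → enum V j ≡ v) → Path (map (Product.map (enum V) (enum V)) E) (enum V i) v
    helper _ (j , refl) = Path-map⁺ (enum V) (paths j _)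

-- This is s(V), with `V` a predicate because `F` enumerates vertex sets in that form.
spanning : Graph n → (Fin n → Bool) → ℕ
spanning G V = countSublists (λ E → insideB V E ∧ connectedB V E) (edges G)

h≡countSublists : ∀ m → h m ≡ countSublists (connectedB (λ _ → true)) (allPairs m)
h≡countSublists m = count-pick (connectedB (λ _ → true)) (allPairs m)

-- After relabeling `V`, the count differs from `h ∣ V ∣` only in the pairs that are available.
-- Fewer pairs give the upper bound, all pairs give equality.
spanning-enum : (G : Graph n) (V : Subset n) → spanning G (lookup V) ≡
  countSublists (connectedB (λ _ → true))
    (filterᵇ (λ (i , j) → adj G (enum V i) (enum V j)) (allPairs ∣ V ∣))
spanning-enum {n} G V = begin
  spanning G (lookup V)
    ≡⟨ countSublists-all (both (lookup V)) (connectedB (lookup V)) (edges G) ⟩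
  conn (filterᵇ (both (lookup V)) (edges G))
    ≡⟨ cong (conn ∘ filterᵇ _) (edgesOf-filter (adj G)) ⟩
  conn (filterᵇ (both (lookup V)) (filterᵇ (uncurry (adj G)) (allPairs n)))
    -- Restricting to `V` first leaves a complete list of pairs, which `enum V` can relabel;
    -- adjacency is tested afterwards.
    ≡⟨ cong conn (filterᵇ-comm _ _ (allPairs n)) ⟩
  conn (filterᵇ (uncurry (adj G)) (filterᵇ (both (lookup V)) (allPairs n)))
    ≡⟨ cong (conn ∘ filterᵇ (uncurry (adj G))) (filterᵇ-allPairs V) ⟩
  conn (filterᵇ (uncurry (adj G)) (map (Product.map (enum V) (enum V)) (allPairs ∣ V ∣)))
    ≡⟨ cong conn (filterᵇ-map _ _ (allPairs ∣ V ∣)) ⟩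
  conn (map (Product.map (enum V) (enum V)) L)
    ≡⟨ countSublists-map _ _ L ⟩
  countSublists (connectedB (lookup V) ∘ map (Product.map (enum V) (enum V))) L
    ≡⟨ countSublists-cong (connectedB-enum V) L ⟩
  countSublists (connectedB (λ _ → true)) L ∎
  where
  open ≡-Reasoning
  conn = countSublists (connectedB (lookup V))
  L = filterᵇ (λ (i , j) → adj G (enum V i) (enum V j)) (allPairs ∣ V ∣)

spanning-≤ : (G : Graph n) (V : Subset n) → spanning G (lookup V) ≤ h ∣ V ∣
spanning-≤ G V rewrite spanning-enum G V | h≡countSublists ∣ V ∣ = countSublists-filter-≤ _ _ (allPairs ∣ V ∣)

spanning-complete : (G : Graph n) (V : Subset n) →
  (∀ {i j} → i ∈ V → j ∈ V → i ≢ j → T (adj G i j)) → spanning G (lookup V) ≡ h ∣ V ∣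
spanning-complete G V complete rewrite spanning-enum G V | h≡countSublists ∣ V ∣ =
  cong (countSublists _) (filterᵇ-allPairs-complete _ (λ {i} {j} i≢j →
    complete (mem i) (mem j) (i≢j ∘ enum-injective V)))
  where
  mem : ∀ i → enum V i ∈ V
  mem i = lookup⇒[]= _ V (to T-≡ (enum-∈ V i))

∈-edges⁻ : (G : Graph n) → ∀ {i j} → (i , j) ∈ˡ edges G → T (adj G i j)
∈-edges⁻ {n} G {i} {j} m rewrite edgesOf-filter (adj G) = proj₂ (∈-filter⁻ (T? ∘ uncurry (adj G)) {xs = allPairs n} m)

∈-edges⁺ : (G : Graph n) → ∀ {i j} → toℕ i < toℕ j → T (adj G i j) → (i , j) ∈ˡ edges G
∈-edges⁺ {n} G {i} {j} i<j t = ∈-concatMap⁺ (λ i → concatMap (cell i) (allFin n)) {xs = allFin n}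
  (lose (∈-allFin i) (∈-concatMap⁺ (cell i) {xs = allFin n} (lose (∈-allFin j) here-cell)))
  where
  cell : Fin n → Fin n → List (Edge n)
  cell i j = if (toℕ i <ᵇ toℕ j) ∧ adj G i j then (i , j) ∷ [] else []
  here-cell : (i , j) ∈ˡ cell i j
  here-cell rewrite to T-≡ (<⇒<ᵇ i<j) | to T-≡ t = here refl

-- Serves two purposes: the paths place `V` in a single component, and for a two-element `V` the
-- first link of a path yields the edge.
spanning-witness : (G : Graph n) (V : Subset n) → 0 < spanning G (lookup V) →
  ∃ λ E → (∀ {i j} → Link E i j → i ∈ V × j ∈ V) × (∀ {e} → e ∈ˡ E → e ∈ˡ edges G)
          × (∀ {i j} → i ∈ V → j ∈ V → Path E i j)
spanning-witness G V 0< with countSublists-witness _ (edges G) 0<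
... | E , t , E⊆ with to (T-∧ {insideB (lookup V) E}) t
... | ins , con = E , link , E⊆ , path (connectedB⇒Connected con)
  where
  mem : ∀ {i} → T (lookup V i) → i ∈ V
  mem t = lookup⇒[]= _ V (to T-≡ t)
  in-V : ∀ {i j} → (i , j) ∈ˡ E → i ∈ V × j ∈ V
  in-V {i} m = Product.map mem mem (to (T-∧ {lookup V i}) (All.lookup (all⁺ _ E ins) m))
  link : ∀ {i j} → Link E i j → i ∈ V × j ∈ V
  link (inj₁ m) = in-V m
  link (inj₂ m) = Product.swap (in-V m)
  path : Connected (lookup V) E → ∀ {i j} → i ∈ V → j ∈ V → Path E i j
  path (u , _ , p) i∈V j∈V = Path-sym (p _ (from T-≡ ([]=⇒lookup i∈V))) ◅◅ p _ (from T-≡ ([]=⇒lookup j∈V))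

-- Sums over subsets

-- The subsets of `p` remain vectors of length `n`, so that they can be united with subsets of
-- `∁ p`.
∑⊆ : Subset n → (Subset n → ℕ) → ℕ
∑⊆ []          f = f []
∑⊆ (true  ∷ p) f = ∑⊆ p (f ∘ (false ∷_)) + ∑⊆ p (f ∘ (true ∷_))
∑⊆ (false ∷ p) f = ∑⊆ p (f ∘ (false ∷_))

∑∈ : Subset n → (Fin n → ℕ) → ℕ
∑∈ []          g = 0
∑∈ (true  ∷ p) g = g zero + ∑∈ p (g ∘ suc)
∑∈ (false ∷ p) g = ∑∈ p (g ∘ suc)

∑⊆-cong : (p : Subset n) {f g : Subset n → ℕ} → (∀ A → A ⊆ p → f A ≡ g A) → ∑⊆ p f ≡ ∑⊆ p g
∑⊆-cong []          f≡g = f≡g [] id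
∑⊆-cong (true  ∷ p) f≡g = cong₂ _+_ (∑⊆-cong p (λ A A⊆p → f≡g _ (out⊆ A⊆p)))
                                   (∑⊆-cong p (λ A A⊆p → f≡g _ (in⊆in A⊆p)))
∑⊆-cong (false ∷ p) f≡g = ∑⊆-cong p (λ A A⊆p → f≡g _ (out⊆ A⊆p))

∑⊆-mono : (p : Subset n) {f g : Subset n → ℕ} → (∀ A → A ⊆ p → f A ≤ g A) → ∑⊆ p f ≤ ∑⊆ p g
∑⊆-mono []          f≤g = f≤g [] id
∑⊆-mono (true  ∷ p) f≤g = +-mono-≤ (∑⊆-mono p (λ A A⊆p → f≤g _ (out⊆ A⊆p)))
                                  (∑⊆-mono p (λ A A⊆p → f≤g _ (in⊆in A⊆p)))
∑⊆-mono (false ∷ p) f≤g = ∑⊆-mono p (λ A A⊆p → f≤g _ (out⊆ A⊆p))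

+-tight : ∀ {a b c d} → a ≤ c → b ≤ d → c + d ≤ a + b → c ≤ a × d ≤ b
+-tight {a} {b} {c} {d} a≤c b≤d le =
  +-cancelʳ-≤ d c a (≤-trans le (+-monoʳ-≤ a b≤d)) ,
  +-cancelˡ-≤ c d b (≤-trans le (+-monoˡ-≤ b a≤c))

-- Termwise bounds whose totals agree leave no slack in any term. The equality case is thereby read
-- off one set at a time.
∑⊆-tight : (p : Subset n) {f g : Subset n → ℕ} → (∀ A → A ⊆ p → f A ≤ g A) →
           ∑⊆ p g ≤ ∑⊆ p f → ∀ A → A ⊆ p → g A ≤ f A
∑⊆-tight []          f≤g le [] _ = le
∑⊆-tight (true ∷ p) f≤g le (b ∷ A) A⊆p
  with +-tight (∑⊆-mono p (λ A A⊆p → f≤g _ (out⊆ A⊆p))) (∑⊆-mono p (λ A A⊆p → f≤g _ (in⊆in A⊆p))) le | b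
... | le₁ , le₂ | false = ∑⊆-tight p (λ A A⊆p → f≤g _ (out⊆ A⊆p)) le₁ A (drop-∷-⊆ A⊆p)
... | le₁ , le₂ | true  = ∑⊆-tight p (λ A A⊆p → f≤g _ (in⊆in A⊆p)) le₂ A (drop-∷-⊆ A⊆p)
∑⊆-tight (false ∷ p) f≤g le (false ∷ A) A⊆p = ∑⊆-tight p (λ A A⊆p → f≤g _ (out⊆ A⊆p)) le A (drop-∷-⊆ A⊆p)
∑⊆-tight (false ∷ p) f≤g le (true ∷ A) A⊆p with () ← A⊆p here

∑⊆-+ : (p : Subset n) (f g : Subset n → ℕ) → ∑⊆ p (λ A → f A + g A) ≡ ∑⊆ p f + ∑⊆ p g
∑⊆-+ []          f g = refl
∑⊆-+ (false ∷ p) f g = ∑⊆-+ p _ _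
∑⊆-+ (true  ∷ p) f g = trans (cong₂ _+_ (∑⊆-+ p _ _) (∑⊆-+ p _ _))
  (interchange (∑⊆ p (f ∘ (false ∷_))) _ _ _)

-- Every set splits uniquely into a part outside `p` and a part inside `p`.
∑⊆-∪ : (p : Subset n) (f : Subset n → ℕ) → ∑⊆ ⊤ f ≡ ∑⊆ (∁ p) (λ U → ∑⊆ p (λ A → f (U ∪ A)))
∑⊆-∪ []          f = refl
∑⊆-∪ (false ∷ p) f = cong₂ _+_ (∑⊆-∪ p _) (∑⊆-∪ p _)
∑⊆-∪ (true  ∷ p) f = trans (cong₂ _+_ (∑⊆-∪ p _) (∑⊆-∪ p _)) (sym (∑⊆-+ (∁ p) _ _))

∑⊆-∅≤ : (p : Subset n) (f : Subset n → ℕ) → f ⊥ ≤ ∑⊆ p f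
∑⊆-∅≤ []          f = ≤-refl
∑⊆-∅≤ (true  ∷ p) f = ≤-trans (∑⊆-∅≤ p _) (m≤m+n _ _)
∑⊆-∅≤ (false ∷ p) f = ∑⊆-∅≤ p _

-- Terms with two or more elements are discarded; of the half containing `zero` only `⁅ zero ⁆` is
-- kept.
∑⊆-singletons≤ : (p : Subset n) (f : Subset n → ℕ) → f ⊥ + ∑∈ p (f ∘ ⁅_⁆) ≤ ∑⊆ p f
∑⊆-singletons≤ []          f = ≤-reflexive (+-identityʳ _)
∑⊆-singletons≤ (false ∷ p) f = ∑⊆-singletons≤ p _
∑⊆-singletons≤ (true  ∷ p) f = begin
  f ⊥ + (f ⁅ zero ⁆ + s) ≡⟨ cong (f ⊥ +_) (+-comm _ s) ⟩
  f ⊥ + (s + f ⁅ zero ⁆) ≡⟨ +-assoc (f ⊥) s _ ⟨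
  (f ⊥ + s) + f ⁅ zero ⁆ ≤⟨ +-mono-≤ (∑⊆-singletons≤ p _) (∑⊆-∅≤ p _) ⟩
  ∑⊆ p (f ∘ (false ∷_)) + ∑⊆ p (f ∘ (true ∷_)) ∎
  where
  open ≤-Reasoning
  s = ∑∈ p (λ i → f (false ∷ ⁅ i ⁆))

∑⊆-≤∅ : (p : Subset n) (f : Subset n → ℕ) →
        (∀ A {i} → i ∈ p → i ∈ A → f A ≡ 0) → ∑⊆ p f ≤ f ⊥
∑⊆-≤∅ []          f z = ≤-refl
∑⊆-≤∅ (false ∷ p) f z = ∑⊆-≤∅ p _ (λ A i∈p i∈A → z _ (there i∈p) (there i∈A))
∑⊆-≤∅ (true  ∷ p) f z = begin
  ∑⊆ p (f ∘ (false ∷_)) + ∑⊆ p (f ∘ (true ∷_))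
    ≤⟨ +-mono-≤ (∑⊆-≤∅ p _ (λ A i∈p i∈A → z _ (there i∈p) (there i∈A)))
                (∑⊆-≤∅ p _ (λ A i∈p i∈A → z _ (there i∈p) (there i∈A))) ⟩
  f ⊥ + f (true ∷ ⊥) ≡⟨ cong (f ⊥ +_) (z (true ∷ ⊥) here here) ⟩
  f ⊥ + 0            ≡⟨ +-identityʳ _ ⟩
  f ⊥ ∎
  where open ≤-Reasoning

∑⊆-≤singletons : (p : Subset n) (f : Subset n → ℕ) →
  (∀ A {i j} → i ∈ p → j ∈ p → i ∈ A → j ∈ A → i ≢ j → f A ≡ 0) →
  ∑⊆ p f ≤ f ⊥ + ∑∈ p (f ∘ ⁅_⁆)
∑⊆-≤singletons []          f z = ≤-reflexive (sym (+-identityʳ _))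
∑⊆-≤singletons (false ∷ p) f z = ∑⊆-≤singletons p _
  (λ A i∈p j∈p i∈A j∈A i≢j → z _ (there i∈p) (there j∈p) (there i∈A) (there j∈A) (i≢j ∘ suc-injective))
∑⊆-≤singletons (true  ∷ p) f z = begin
  ∑⊆ p (f ∘ (false ∷_)) + ∑⊆ p (f ∘ (true ∷_))
    ≤⟨ +-mono-≤ (∑⊆-≤singletons p _ (λ A i∈p j∈p i∈A j∈A i≢j →
                   z _ (there i∈p) (there j∈p) (there i∈A) (there j∈A) (i≢j ∘ suc-injective)))
                -- In this half `zero` is already chosen, so any further element of `p` makes the
                -- term vanish.
                (∑⊆-≤∅ p _ (λ A i∈p i∈A → z _ here (there i∈p) here (there i∈A) λ ())) ⟩
  (f ⊥ + s) + f ⁅ zero ⁆ ≡⟨ +-assoc (f ⊥) s _ ⟩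
  f ⊥ + (s + f ⁅ zero ⁆) ≡⟨ cong (f ⊥ +_) (+-comm s _) ⟩
  f ⊥ + (f ⁅ zero ⁆ + s) ∎
  where
  open ≤-Reasoning
  s = ∑∈ p (λ i → f (false ∷ ⁅ i ⁆))

∑∈-const : (p : Subset n) (g : Fin n → ℕ) → (∀ {i} → i ∈ p → g i ≡ 1) → ∑∈ p g ≡ ∣ p ∣
∑∈-const []          g g≡1 = refl
∑∈-const (true  ∷ p) g g≡1 = cong₂ _+_ (g≡1 here) (∑∈-const p _ (g≡1 ∘ there))
∑∈-const (false ∷ p) g g≡1 = ∑∈-const p _ (g≡1 ∘ there)

∑∈-≤const : (p : Subset n) (g : Fin n → ℕ) → (∀ {i} → i ∈ p → g i ≤ 1) → ∑∈ p g ≤ ∣ p ∣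
∑∈-≤const []          g g≤1 = z≤n
∑∈-≤const (true  ∷ p) g g≤1 = +-mono-≤ (g≤1 here) (∑∈-≤const p _ (g≤1 ∘ there))
∑∈-≤const (false ∷ p) g g≤1 = ∑∈-≤const p _ (g≤1 ∘ there)

∑∈-witness : (p : Subset n) (g : Fin n → ℕ) → 0 < ∑∈ p g → ∃ λ i → i ∈ p × 0 < g i
∑∈-witness (false ∷ p) g 0< with i , i∈p , 0<gi ← ∑∈-witness p _ 0< = suc i , there i∈p , 0<gi
∑∈-witness (true ∷ p) g 0< with g zero in eq
... | suc _ = zero , here , subst (0 <_) (sym eq) (s≤s z≤n)
... | zero with i , i∈p , 0<gi ← ∑∈-witness p _ 0< = suc i , there i∈p , 0<gi

-- At most one term is positive, so the bound is not multiplied by the number of terms.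
∑∈-≤ : (p : Subset n) (g : Fin n → ℕ) (b : ℕ) →
       (∀ {i j} → i ∈ p → j ∈ p → 0 < g i → 0 < g j → i ≡ j) →
       (∀ {i} → i ∈ p → g i ≤ b) → ∑∈ p g ≤ b
∑∈-≤ []          g b uniq g≤b = z≤n
∑∈-≤ (false ∷ p) g b uniq g≤b =
  ∑∈-≤ p _ b (λ i j gi gj → suc-injective (uniq (there i) (there j) gi gj)) (g≤b ∘ there)
∑∈-≤ (true ∷ p) g b uniq g≤b with ∑∈ p (g ∘ suc) in eq
... | zero = ≤-trans (≤-reflexive (+-identityʳ _)) (g≤b here)
... | suc s with ∑∈-witness p (g ∘ suc) (subst (0 <_) (sym eq) (s≤s z≤n))
... | i , i∈p , 0<gi with g zero in eq₀
... | suc _ with () ← uniq here (there i∈p) (subst (0 <_) (sym eq₀) (s≤s z≤n)) 0<gi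
... | zero = subst (_≤ b) eq
  (∑∈-≤ p _ b (λ i j gi gj → suc-injective (uniq (there i) (there j) gi gj)) (g≤b ∘ there))

-- The sum of `(m C i) * g i` for i from 0 to m, in the recursive form that matches `∑⊆`: one fixed
-- element is left out or chosen.
binomialSum : ℕ → (ℕ → ℕ) → ℕ
binomialSum zero    g = g 0
binomialSum (suc m) g = binomialSum m g + binomialSum m (g ∘ suc)

∑⊆-card : (p : Subset n) (g : ℕ → ℕ) → ∑⊆ p (g ∘ ∣_∣) ≡ binomialSum ∣ p ∣ g
∑⊆-card []          g = refl
∑⊆-card (true  ∷ p) g = cong₂ _+_ (∑⊆-card p g) (∑⊆-card p (g ∘ suc))
∑⊆-card (false ∷ p) g = ∑⊆-card p g

sum1-cong : ∀ m {f g : ℕ → ℕ} → (∀ i → f (suc i) ≡ g (suc i)) → sum1 m f ≡ sum1 m g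
sum1-cong zero    f≡g = refl
sum1-cong (suc m) f≡g = cong₂ _+_ (sum1-cong m f≡g) (f≡g m)

sum1-+ : ∀ m (f g : ℕ → ℕ) → sum1 m (λ i → f i + g i) ≡ sum1 m f + sum1 m g
sum1-+ zero    f g = refl
sum1-+ (suc m) f g = trans (cong (_+ (f (suc m) + g (suc m))) (sum1-+ m f g)) (interchange (sum1 m f) _ _ _)

sum1-suc : ∀ m (f : ℕ → ℕ) → sum1 (suc m) f ≡ f 1 + sum1 m (f ∘ suc)
sum1-suc zero    f = sym (+-identityʳ _)
sum1-suc (suc m) f = trans (cong (_+ f (suc (suc m))) (sum1-suc m f)) (+-assoc (f 1) _ _)

-- Pascal's rule applied to each coefficient. The term of index 0 stands apart because `sum1` starts
-- at 1.
binomialSum-formula : ∀ m g → binomialSum m g ≡ g 0 + sum1 m (λ i → (m C i) * g i)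
binomialSum-formula zero    g = sym (+-identityʳ _)
binomialSum-formula (suc m) g = begin
  binomialSum m g + binomialSum m (g ∘ suc)
    ≡⟨ cong₂ _+_ (binomialSum-formula m g) (binomialSum-formula m (g ∘ suc)) ⟩
  (g 0 + sum1 m α) + (g 1 + sum1 m (β ∘ suc))
    ≡⟨ +-assoc (g 0) (sum1 m α) _ ⟩
  g 0 + (sum1 m α + (g 1 + sum1 m (β ∘ suc)))
    ≡⟨ cong (g 0 +_) (cong₂ _+_ extendα extendβ) ⟩
  g 0 + (sum1 (suc m) α + sum1 (suc m) β)
    ≡⟨ cong (g 0 +_) (sum1-+ (suc m) α β) ⟨
  g 0 + sum1 (suc m) (λ i → α i + β i)
    ≡⟨ cong (g 0 +_) (sum1-cong (suc m) pascal) ⟩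
  g 0 + sum1 (suc m) (λ i → (suc m C i) * g i) ∎
  where
  open ≡-Reasoning
  α β : ℕ → ℕ
  α i = (m C i) * g i
  -- Truncation at `i` = 0 is harmless, as `sum1` never evaluates there.
  β i = (m C (i ∸ 1)) * g i

  extendα : sum1 m α ≡ sum1 (suc m) α
  extendα = sym (trans (cong (λ c → sum1 m α + c * g (suc m)) (k>n⇒nCk≡0 (n<1+n m))) (+-identityʳ _))

  extendβ : g 1 + sum1 m (β ∘ suc) ≡ sum1 (suc m) β
  extendβ = trans (cong (_+ sum1 m (β ∘ suc)) (sym (*-identityˡ (g 1)))) (sym (sum1-suc m β))

  pascal : ∀ i → α (suc i) + β (suc i) ≡ (suc m C suc i) * g (suc i)
  pascal i = begin
    (m C suc i) * g (suc i) + (m C i) * g (suc i) ≡⟨ *-distribʳ-+ (g (suc i)) (m C suc i) (m C i) ⟨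
    (m C suc i + m C i) * g (suc i)               ≡⟨ cong (_* g (suc i)) (+-comm (m C suc i) _) ⟩
    (m C i + m C suc i) * g (suc i)               ≡⟨ cong (_* g (suc i)) (nCk+nC[k+1]≡[n+1]C[k+1] m i) ⟩
    (suc m C suc i) * g (suc i) ∎

-- F as a sum over vertex sets

-- The functions in `subsets` agree with `lookup` of a vector only pointwise; `ext` bridges that
-- gap.
sum-subsets : ∀ n (f : (Fin n → Bool) → ℕ) → (∀ {V W} → V ≗ W → f V ≡ f W) →
              sum (map f (subsets n)) ≡ ∑⊆ ⊤ (f ∘ lookup)
sum-subsets zero    f ext = trans (+-identityʳ _) (ext λ ())
sum-subsets (suc n) f ext = trans (sum-branch f (extend false) (extend true) (subsets n))
  (cong₂ _+_ (half false) (half true))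
  where
  half : ∀ b → sum (map (f ∘ extend b) (subsets n)) ≡ ∑⊆ ⊤ (λ V → f (lookup (b ∷ V)))
  half b = trans
    (sum-subsets n (f ∘ extend b) (λ V≗W → ext (λ { zero → refl ; (suc i) → V≗W i })))
    (∑⊆-cong (⊤ {n}) (λ V _ → ext {extend b (lookup V)} {lookup (b ∷ V)} (λ { zero → refl ; (suc i) → refl })))

spanning-ext : (G : Graph n) → ∀ {V W} → V ≗ W → spanning G V ≡ spanning G W
spanning-ext {n} G {V} {W} V≗W = countSublists-cong (λ E → cong₂ _∧_
  (all-cong (λ (a , b) → cong₂ _∧_ (V≗W a) (V≗W b)) E)
  (any-cong (λ u → cong₂ _∧_ (V≗W u)
    (all-cong (λ v → cong (λ b → not b ∨ reach E u v) (V≗W v)) (allFin n))) (allFin n))) (edges G)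
  where
  all-cong : ∀ {A : Set} {p q : A → Bool} → p ≗ q → all p ≗ all q
  all-cong p≗q xs = cong and (map-cong p≗q xs)
  any-cong : ∀ {A : Set} {p q : A → Bool} → p ≗ q → any p ≗ any q
  any-cong p≗q xs = cong or (map-cong p≗q xs)

F≡∑⊆ : (G : Graph n) → F G ≡ ∑⊆ ⊤ (spanning G ∘ lookup)
F≡∑⊆ {n} G = begin
  F G
    ≡⟨ count≡sum _ (concatMap (λ V → map (V ,_) ss) (subsets n)) ⟩
  sum (map _ (concatMap (λ V → map (V ,_) ss) (subsets n)))
    ≡⟨ sum-concatMap _ (λ V → map (V ,_) ss) (subsets n) ⟩
  sum (map (λ V → sum (map _ (map (V ,_) ss))) (subsets n))
    ≡⟨ cong sum (map-cong (λ V → begin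
         _ ≡⟨ cong sum (map-∘ ss) ⟨
         _ ≡⟨ count≡sum (P V ∘ pick (edges G)) ss ⟨
         _ ≡⟨ count-pick (P V) (edges G) ⟩
         spanning G V ∎) (subsets n)) ⟩
  sum (map (spanning G) (subsets n))
    ≡⟨ sum-subsets n (spanning G) (spanning-ext G) ⟩
  ∑⊆ ⊤ (spanning G ∘ lookup) ∎
  where
  open ≡-Reasoning
  ss = bools (length (edges G))
  P : (Fin n → Bool) → List (Edge n) → Bool
  P V E = insideB V E ∧ connectedB V E

-- Subset sizes and the value of the bound

0<∣p∣⇒Nonempty : (p : Subset n) → 0 < ∣ p ∣ → Nonempty p
0<∣p∣⇒Nonempty (true  ∷ p) _  = zero , here
0<∣p∣⇒Nonempty (false ∷ p) 0< with i , i∈p ← 0<∣p∣⇒Nonempty p 0< = suc i , there i∈p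

∣p∪⁅x⁆∣ : (p : Subset n) → ∀ {x} → x ∉ p → ∣ p ∪ ⁅ x ⁆ ∣ ≡ suc ∣ p ∣
∣p∪⁅x⁆∣ (true  ∷ p) {zero}  x∉p = ⊥-elim (x∉p here)
∣p∪⁅x⁆∣ (false ∷ p) {zero}  x∉p = cong (suc ∘ ∣_∣) (∪-identityʳ p)
∣p∪⁅x⁆∣ (true  ∷ p) {suc x} x∉p = cong suc (∣p∪⁅x⁆∣ p (x∉p ∘ there))
∣p∪⁅x⁆∣ (false ∷ p) {suc x} x∉p = ∣p∪⁅x⁆∣ p (x∉p ∘ there)

∣p∣≡1+∣p-x∣ : (p : Subset n) → ∀ {x} → x ∈ p → ∣ p ∣ ≡ suc ∣ p - x ∣
∣p∣≡1+∣p-x∣ (true  ∷ p) here        = cong (suc ∘ ∣_∣) (sym (p─⊥≡p p))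
∣p∣≡1+∣p-x∣ (true  ∷ p) (there x∈p) = cong suc (∣p∣≡1+∣p-x∣ p x∈p)
∣p∣≡1+∣p-x∣ (false ∷ p) (there x∈p) = ∣p∣≡1+∣p-x∣ p x∈p

x∉p-x : (p : Subset n) → ∀ x → x ∉ p - x
x∉p-x (b ∷ p) (suc x) (there m) = x∉p-x p x m

∉⇒T-not : (p : Subset n) → ∀ {x} → x ∉ p → T (not (lookup p x))
∉⇒T-not p {x} x∉p with lookup p x in eq
... | true  = x∉p (lookup⇒[]= x p eq)
... | false = _

T-not⇒∉ : (p : Subset n) → ∀ {x} → T (not (lookup p x)) → x ∉ p
T-not⇒∉ p t x∈p rewrite []=⇒lookup x∈p = t

binomialSum-+ : ∀ m f g → binomialSum m (λ i → f i + g i) ≡ binomialSum m f + binomialSum m g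
binomialSum-+ zero    f g = refl
binomialSum-+ (suc m) f g = trans (cong₂ _+_ (binomialSum-+ m f g) (binomialSum-+ m _ _))
  (interchange (binomialSum m f) _ _ _)

-- Expresses a surplus of the empty set through its size, so that the whole bound is a function of
-- the size alone.
onlyAt0 : ℕ → ℕ → ℕ
onlyAt0 c zero    = c
onlyAt0 c (suc _) = 0

binomialSum-0 : ∀ m → binomialSum m (λ _ → 0) ≡ 0
binomialSum-0 zero    = refl
binomialSum-0 (suc m) = cong₂ _+_ (binomialSum-0 m) (binomialSum-0 m)

binomialSum-onlyAt0 : ∀ m c → binomialSum m (onlyAt0 c) ≡ c
binomialSum-onlyAt0 zero    c = refl
binomialSum-onlyAt0 (suc m) c =
  trans (cong₂ _+_ (binomialSum-onlyAt0 m c) (binomialSum-0 m)) (+-identityʳ c)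

coreBound : ℕ → ℕ → ℕ
coreBound n k = (k ∸ 1) + sum1 (n ∸ k + 1) (λ i → ((n ∸ k + 1) C i) * h i)

-- The term of the empty set does not show, as `h 0` computes to 0.
coreBound≡ : ∀ n k → coreBound n k ≡ (k ∸ 1) + binomialSum (suc (n ∸ k)) h
coreBound≡ n k rewrite +-comm (n ∸ k) 1 = cong ((k ∸ 1) +_) (sym (binomialSum-formula (suc (n ∸ k)) h))

-- Components

isRoot : Graph n → Fin n → Bool
isRoot {n} G u = all (λ v → not (toℕ v <ᵇ toℕ u) ∨ not (reach (edges G) u v)) (allFin n)

roots : Graph n → Subset n
roots G = Vec.tabulate (isRoot G)

count-tabulate : ∀ {A : Set} (p : A → Bool) (f : Fin n → A) →
                 count p (List.tabulate f) ≡ ∣ Vec.tabulate (p ∘ f) ∣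
count-tabulate {zero}  p f = refl
count-tabulate {suc n} p f with p (f zero)
... | true  = cong suc (count-tabulate p (f ∘ suc))
... | false = count-tabulate p (f ∘ suc)

components≡∣roots∣ : (G : Graph n) → components G ≡ ∣ roots G ∣
components≡∣roots∣ G = count-tabulate (isRoot G) id

module _ (G : Graph n) where

  private
    s : Subset n → ℕ
    s V = spanning G (lookup V)

    R : Subset n
    R = roots G

  root-minimal : ∀ {i j} → i ∈ R → Path (edges G) i j → ¬ (toℕ j < toℕ i)
  root-minimal {i} {j} i∈R p j<i = T-¬
    (T-implies⁻ (all-allFin⁻ {p = λ v → not (toℕ v <ᵇ toℕ i) ∨ not (reach (edges G) i v)}
                             (∈-tabulate⁻ i∈R) j)
                (<⇒<ᵇ j<i))
    (Path⇒reach (edges G) i p)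
    where
    T-¬ : ∀ {b} → T (not b) → ¬ T b
    T-¬ {false} _ ()

  -- Both are least in the same component, so neither is below the other.
  root-unique : ∀ {i j} → i ∈ R → j ∈ R → Path (edges G) i j → i ≡ j
  root-unique {i} {j} i∈R j∈R p = toℕ-injective
    (≤-antisym (≮⇒≥ (root-minimal i∈R p)) (≮⇒≥ (root-minimal j∈R (Path-sym p))))

  spanning⇒Path : ∀ V → 0 < s V → ∀ {i j} → i ∈ V → j ∈ V → Path (edges G) i j
  spanning⇒Path V 0< i∈V j∈V with spanning-witness G V 0<
  ... | E , _ , E⊆ , paths = Path-mono E⊆ (paths i∈V j∈V)

  Link-edges⇒adj : ∀ {i j} → Link (edges G) i j → T (adj G i j)
  Link-edges⇒adj (inj₁ m) = ∈-edges⁻ G m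
  Link-edges⇒adj {i} {j} (inj₂ m) = subst T (adj-sym G j i) (∈-edges⁻ G m)

  adj⇒≢ : ∀ {i j} → T (adj G i j) → i ≢ j
  adj⇒≢ {i} t refl rewrite adj-irrefl G i = t

  -- A path from `x` to `y` begins with a link inside the pair; there are no loops, so this link
  -- ends in `y`.
  spanning-pair⇒adj : ∀ {x y} → x ≢ y → 0 < s (⁅ x ⁆ ∪ ⁅ y ⁆) → T (adj G x y)
  spanning-pair⇒adj {x} {y} x≢y 0< with spanning-witness G (⁅ x ⁆ ∪ ⁅ y ⁆) 0<
  ... | E , inside , E⊆ , paths
      with paths (x∈p∪q⁺ (inj₁ (x∈⁅x⁆ x))) (x∈p∪q⁺ {p = ⁅ x ⁆} (inj₂ (x∈⁅x⁆ y)))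
  ... | ε = ⊥-elim (x≢y refl)
  ... | _◅_ {j = z} l _ = neighbour (x∈p∪q⁻ ⁅ x ⁆ ⁅ y ⁆ (proj₂ (inside l)))
    where
    xz : T (adj G x z)
    xz = Link-edges⇒adj (Sum.map E⊆ E⊆ l)
    neighbour : z ∈ ⁅ x ⁆ ⊎ z ∈ ⁅ y ⁆ → T (adj G x y)
    neighbour (inj₁ z∈x) = ⊥-elim (adj⇒≢ xz (sym (x∈⁅y⁆⇒x≡y x z∈x)))
    neighbour (inj₂ z∈y) = subst (T ∘ adj G x) (x∈⁅y⁆⇒x≡y y z∈y) xz

  adj⇒Link : ∀ {i j} → T (adj G i j) → Link (edges G) i j
  adj⇒Link {i} {j} t with <-cmp (toℕ i) (toℕ j)
  ... | tri< i<j _ _ = inj₁ (∈-edges⁺ G i<j t)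
  ... | tri≈ _ i≡j _ = ⊥-elim (adj⇒≢ t (toℕ-injective i≡j))
  ... | tri> _ _ j<i = inj₂ (∈-edges⁺ G j<i (subst T (adj-sym G i j) t))

  -- The upper bound, fibre by fibre

  rooted : Subset n → ℕ
  rooted U = ∑∈ R (λ r → s (U ∪ ⁅ r ⁆))

  -- A set with two distinct roots meets two components and contributes nothing, so only the empty
  -- `A` and the singletons remain.
  fibre-≤ : ∀ U → ∑⊆ R (λ A → s (U ∪ A)) ≤ s U + rooted U
  fibre-≤ U = subst (λ V → ∑⊆ R (λ A → s (U ∪ A)) ≤ s V + rooted U) (∪-identityʳ U)
    (∑⊆-≤singletons R (λ A → s (U ∪ A)) λ A i∈R j∈R i∈A j∈A i≢j →
      n≤0⇒n≡0 (≮⇒≥ λ 0< → i≢j (root-unique i∈R j∈R (spanning⇒Path (U ∪ A) 0<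
        (x∈p∪q⁺ {p = U} (inj₂ i∈A)) (x∈p∪q⁺ {p = U} (inj₂ j∈A))))))

  spanning-root-≤ : ∀ {U} → U ⊆ ∁ R → ∀ {r} → r ∈ R → s (U ∪ ⁅ r ⁆) ≤ h (suc ∣ U ∣)
  spanning-root-≤ {U} U⊆∁R {r} r∈R = subst (λ m → s (U ∪ ⁅ r ⁆) ≤ h m)
    (∣p∪⁅x⁆∣ U (λ r∈U → x∈∁p⇒x∉p (U⊆∁R r∈U) r∈R)) (spanning-≤ G (U ∪ ⁅ r ⁆))

  -- Every root with a positive term is joined by a path to the same `u`, so there is at most one
  -- such root.
  rooted-≤ : ∀ {U} → U ⊆ ∁ R → Nonempty U → rooted U ≤ h (suc ∣ U ∣)
  rooted-≤ {U} U⊆∁R (u , u∈U) = ∑∈-≤ R _ _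
    (λ {i} {j} i∈R j∈R 0<i 0<j → root-unique i∈R j∈R (Path-sym (path 0<i) ◅◅ path 0<j))
    (spanning-root-≤ U⊆∁R)
    where
    path : ∀ {r} → 0 < s (U ∪ ⁅ r ⁆) → Path (edges G) u r
    path {r} 0< = spanning⇒Path (U ∪ ⁅ r ⁆) 0< (x∈p∪q⁺ (inj₁ u∈U)) (x∈p∪q⁺ {p = U} (inj₂ (x∈⁅x⁆ r)))

  module _ (0<∣R∣ : 0 < ∣ R ∣) where

    private
      c : ℕ
      c = ∣ R ∣

      -- For nonempty `U` the first two summands suffice. At size 0 they total 1, whereas all `c`
      -- single roots contribute; the surplus `c ∸ 1` makes up the difference.
      bound : ℕ → ℕ
      bound m = (h m + h (suc m)) + onlyAt0 (c ∸ 1) m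

    fibre-≤-bound : ∀ U → U ⊆ ∁ R → ∑⊆ R (λ A → s (U ∪ A)) ≤ bound ∣ U ∣
    fibre-≤-bound U U⊆∁R with nonempty? U
    ... | yes ne = ≤-trans (fibre-≤ U)
      (≤-trans (+-mono-≤ (spanning-≤ G U) (rooted-≤ U⊆∁R ne)) (m≤m+n _ _))
    ... | no empty with ∣ U ∣ in eq
    ... | suc m = ⊥-elim (empty (0<∣p∣⇒Nonempty U (subst (0 <_) (sym eq) (s≤s z≤n))))
    ... | zero = begin
      ∑⊆ R (λ A → s (U ∪ A)) ≤⟨ fibre-≤ U ⟩
      -- Here `h 0` and `h 1` compute to 0 and 1: `s U` vanishes and each root counts at most once.
      s U + rooted U         ≤⟨ +-mono-≤ (subst (λ m → s U ≤ h m) eq (spanning-≤ G U))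
                                         (∑∈-≤const R _ (λ {r} r∈R → subst (λ m → s (U ∪ ⁅ r ⁆) ≤ h (suc m)) eq (spanning-root-≤ U⊆∁R r∈R))) ⟩
      c                      ≡⟨ m+[n∸m]≡n 0<∣R∣ ⟨
      1 + (c ∸ 1)            ∎
      where open ≤-Reasoning

    -- Summing `h` and its shift over subsets of the non-roots is, by the recursion of
    -- `binomialSum`, summing `h` over one more point, which stands for all roots merged.
    ∑-bound : ∑⊆ (∁ R) (bound ∘ ∣_∣) ≡ coreBound n c
    ∑-bound = begin
      ∑⊆ (∁ R) (bound ∘ ∣_∣)       ≡⟨ ∑⊆-card (∁ R) bound ⟩
      binomialSum (∣ ∁ R ∣) bound   ≡⟨ cong (λ m → binomialSum m bound) (∣∁p∣≡n∸∣p∣ R) ⟩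
      binomialSum m bound          ≡⟨ binomialSum-+ m _ (onlyAt0 (c ∸ 1)) ⟩
      binomialSum m (λ i → h i + h (suc i)) + binomialSum m (onlyAt0 (c ∸ 1))
        ≡⟨ cong₂ _+_ (binomialSum-+ m h (h ∘ suc)) (binomialSum-onlyAt0 m _) ⟩
      binomialSum (suc m) h + (c ∸ 1) ≡⟨ +-comm _ (c ∸ 1) ⟩
      (c ∸ 1) + binomialSum (suc m) h ≡⟨ coreBound≡ n c ⟨
      coreBound n c            ∎
      where
      open ≡-Reasoning
      m = n ∸ c

    F≡∑fibres : F G ≡ ∑⊆ (∁ R) (λ U → ∑⊆ R (λ A → s (U ∪ A)))
    F≡∑fibres = trans (F≡∑⊆ G) (∑⊆-∪ R s)

    F-≤ : F G ≤ coreBound n c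
    F-≤ = begin
      F G                                            ≡⟨ F≡∑fibres ⟩
      ∑⊆ (∁ R) (λ U → ∑⊆ R (λ A → s (U ∪ A)))        ≤⟨ ∑⊆-mono (∁ R) fibre-≤-bound ⟩
      ∑⊆ (∁ R) (bound ∘ ∣_∣)                         ≡⟨ ∑-bound ⟩
      coreBound n c                              ∎
      where open ≤-Reasoning

    module _ (F≡ : F G ≡ coreBound n ∣ R ∣) where

      -- Equal totals make each fibre attain its bound, and then each of its two summands attains
      -- its own.
      fibre-tight : ∀ U → U ⊆ ∁ R → Nonempty U → h ∣ U ∣ ≤ s U × h (suc ∣ U ∣) ≤ rooted U
      fibre-tight U U⊆∁R ne = +-tight (spanning-≤ G U) (rooted-≤ U⊆∁R ne)
        (≤-trans (m≤m+n _ _) (≤-trans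
          (∑⊆-tight (∁ R) fibre-≤-bound (≤-reflexive (trans ∑-bound (trans (sym F≡) F≡∑fibres))) U U⊆∁R)
          (fibre-≤ U)))

      nonroots-adj : ∀ {u v} → u ∈ ∁ R → v ∈ ∁ R → u ≢ v → T (adj G u v)
      nonroots-adj {u} {v} u∈ v∈ u≢v = spanning-pair⇒adj u≢v
        -- Since `h 2` computes to 1, tightness says that `s U` is positive.
        (subst (λ m → h m ≤ s U) ∣U∣≡2 (proj₁ (fibre-tight U U⊆ (u , x∈p∪q⁺ (inj₁ (x∈⁅x⁆ u))))))
        where
        U = ⁅ u ⁆ ∪ ⁅ v ⁆
        U⊆ : U ⊆ ∁ R
        U⊆ x∈U with x∈p∪q⁻ ⁅ u ⁆ ⁅ v ⁆ x∈U
        ... | inj₁ x∈u rewrite x∈⁅y⁆⇒x≡y u x∈u = u∈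
        ... | inj₂ x∈v rewrite x∈⁅y⁆⇒x≡y v x∈v = v∈
        ∣U∣≡2 : ∣ U ∣ ≡ 2
        ∣U∣≡2 = trans (∣p∪⁅x⁆∣ ⁅ u ⁆ (λ v∈u → u≢v (sym (x∈⁅y⁆⇒x≡y u v∈u)))) (cong suc (∣⁅x⁆∣≡1 u))

      nonroot-adj-root : ∀ {v} → v ∈ ∁ R → ∃ λ r → r ∈ R × T (adj G v r)
      nonroot-adj-root {v} v∈ = adjacent (∑∈-witness R _
        -- Again `h 2` is 1, so some root has a positive term.
        (subst (λ m → h (suc m) ≤ rooted ⁅ v ⁆) (∣⁅x⁆∣≡1 v) (proj₂ (fibre-tight ⁅ v ⁆ U⊆ (v , x∈⁅x⁆ v)))))
        where
        U⊆ : ⁅ v ⁆ ⊆ ∁ R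
        U⊆ x∈v rewrite x∈⁅y⁆⇒x≡y v x∈v = v∈
        adjacent : (∃ λ r → r ∈ R × 0 < s (⁅ v ⁆ ∪ ⁅ r ⁆)) → ∃ λ r → r ∈ R × T (adj G v r)
        adjacent (r , r∈R , 0<) = r , r∈R , spanning-pair⇒adj (λ { refl → x∈∁p⇒x∉p v∈ r∈R }) 0<

  -- Structure of a graph attaining the bound

  module Extremal
    (0<∣R∣ : 0 < ∣ R ∣)
    (nonroots-adj : ∀ {u v} → u ∈ ∁ R → v ∈ ∁ R → u ≢ v → T (adj G u v))
    (nonroot-adj-root : ∀ {v} → v ∈ ∁ R → ∃ λ r → r ∈ R × T (adj G v r)) where

    -- Any two non-roots are adjacent, so roots adjacent to them lie in one component and coincide.
    -- If there are no non-roots, any root serves.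
    centre : ∃ λ ρ → ρ ∈ R × (∀ {v} → v ∈ ∁ R → T (adj G v ρ))
    centre with nonempty? (∁ R)
    ... | no empty with ρ , ρ∈R ← 0<∣p∣⇒Nonempty R 0<∣R∣ = ρ , ρ∈R , λ {v} v∈ → ⊥-elim (empty (v , v∈))
    ... | yes (w , w∈) with ρ , ρ∈R , wρ ← nonroot-adj-root w∈ = ρ , ρ∈R , adj-ρ
      where
      adj-ρ : ∀ {v} → v ∈ ∁ R → T (adj G v ρ)
      adj-ρ {v} v∈ with v ≟ w
      ... | yes refl = wρ
      ... | no v≢w with r , r∈R , vr ← nonroot-adj-root v∈ =
        subst (T ∘ adj G v) (root-unique r∈R ρ∈R
          (Path-sym (adj⇒Link vr ◅ ε) ◅◅ adj⇒Link (nonroots-adj v∈ w∈ v≢w) ◅ adj⇒Link wρ ◅ ε)) vr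

    ρ = proj₁ centre

    isolated : Subset n
    isolated = R - ρ

    ∉isolated : ∀ {i} → i ∉ isolated → i ∈ ∁ R ⊎ i ≡ ρ
    ∉isolated {i} i∉ with i ∈? R | i ≟ ρ
    ... | no i∉R  | _       = inj₁ (x∉p⇒x∈∁p i∉R)
    ... | yes _   | yes i≡ρ = inj₂ i≡ρ
    ... | yes i∈R | no i≢ρ  = ⊥-elim (i∉ (x∈p∧x≢y⇒x∈p-y i∈R i≢ρ))

    clique-adj : ∀ {i j} → i ≢ j → i ∉ isolated → j ∉ isolated → T (adj G i j)
    clique-adj {i} {j} i≢j i∉ j∉ with ∉isolated i∉ | ∉isolated j∉
    ... | inj₁ i∈   | inj₁ j∈   = nonroots-adj i∈ j∈ i≢j
    ... | inj₁ i∈   | inj₂ refl = proj₂ (proj₂ centre) i∈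
    ... | inj₂ refl | inj₁ j∈   = subst T (adj-sym G j ρ) (proj₂ (proj₂ centre) j∈)
    ... | inj₂ refl | inj₂ refl = ⊥-elim (i≢j refl)

    -- A neighbour of a root is not a root, by uniqueness of roots; being a non-root it is adjacent
    -- to `ρ`, which forces the root to be `ρ` itself.
    adj⇒∉isolated : ∀ {i j} → T (adj G i j) → i ∉ isolated
    adj⇒∉isolated {i} {j} ij i∈D = x∉p-x R ρ (subst (_∈ isolated) i≡ρ i∈D)
      where
      i∈R = p─q⊆p R ⁅ ρ ⁆ i∈D
      i≡ρ : i ≡ ρ
      i≡ρ with j ∈? R
      ... | yes j∈R = ⊥-elim (adj⇒≢ ij (root-unique i∈R j∈R (adj⇒Link ij ◅ ε)))
      ... | no j∉R  = root-unique i∈R (proj₁ (proj₂ centre))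
        (adj⇒Link ij ◅ adj⇒Link (proj₂ (proj₂ centre) (x∉p⇒x∈∁p j∉R)) ◅ ε)

    adj-formula : ∀ i j → adj G i j ≡ not (eqF i j) ∧ not (lookup isolated i) ∧ not (lookup isolated j)
    adj-formula i j = T-ext ⇒ ⇐
      where
      ⇒ : T (adj G i j) → T (not (eqF i j) ∧ not (lookup isolated i) ∧ not (lookup isolated j))
      ⇒ ij = from (T-∧ {not (eqF i j)}) (fromWitnessFalse (adj⇒≢ ij) , from (T-∧ {not (lookup isolated i)})
        (∉⇒T-not isolated (adj⇒∉isolated ij) , ∉⇒T-not isolated (adj⇒∉isolated (subst T (adj-sym G i j) ij))))
      ⇐ : T (not (eqF i j) ∧ not (lookup isolated i) ∧ not (lookup isolated j)) → T (adj G i j)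
      ⇐ t with i≢j , t′ ← to (T-∧ {not (eqF i j)}) t with i∉ , j∉ ← to (T-∧ {not (lookup isolated i)}) t′ =
        clique-adj (toWitnessFalse i≢j) (T-not⇒∉ isolated i∉) (T-not⇒∉ isolated j∉)

-- Isomorphism with `isoClique`

toℕ-punchIn-fromℕ : ∀ n (i : Fin n) → toℕ (punchIn (fromℕ n) i) ≡ toℕ i
toℕ-punchIn-fromℕ (suc n) zero    = refl
toℕ-punchIn-fromℕ (suc n) (suc i) = cong suc (toℕ-punchIn-fromℕ n i)

≤ᵇ-suc : ∀ m n → (suc m ≤ᵇ suc n) ≡ (m ≤ᵇ n)
≤ᵇ-suc zero    n = refl
≤ᵇ-suc (suc m) n = refl

-- A head in `p` goes to position 0 and shifts the others up by one; a head outside `p` goes to the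
-- last position and leaves the others in place.
sorting : (p : Subset n) → ∃ λ (π : Permutation n n) → ∀ i → (∣ p ∣ ≤ᵇ toℕ (π ⟨$⟩ʳ i)) ≡ not (lookup p i)
sorting [] = Perm.id , λ ()
sorting (true ∷ p) with π , sorted ← sorting p =
  lift₀ π , λ { zero → refl ; (suc i) → trans (≤ᵇ-suc ∣ p ∣ _) (sorted i) }
sorting {suc n} (false ∷ p) with π , sorted ← sorting p =
  insert zero (fromℕ n) π ,
  λ { zero    → to T-≡ (≤⇒≤ᵇ (subst (∣ p ∣ ≤_) (sym (toℕ-fromℕ n)) (∣p∣≤n p)))
    ; (suc i) → trans (cong (∣ p ∣ ≤ᵇ_) (trans (cong toℕ (insert-punchIn zero (fromℕ n) π i))
                                              (toℕ-punchIn-fromℕ n _))) (sorted i) }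

eqF-injective : ∀ {m n} (f : Fin m → Fin n) → (∀ {i j} → f i ≡ f j → i ≡ j) → ∀ i j → eqF (f i) (f j) ≡ eqF i j
eqF-injective f f-injective i j = T-ext
  (λ t → fromWitness (f-injective (toWitness t)))
  (λ t → fromWitness (cong f (toWitness t)))

perm-injective : (π : Permutation n n) → ∀ {i j} → π ⟨$⟩ʳ i ≡ π ⟨$⟩ʳ j → i ≡ j
perm-injective π eq = trans (sym (Perm.inverseˡ π)) (trans (cong (π ⟨$⟩ˡ_) eq) (Perm.inverseˡ π))

-- The isolated positions of `isoClique n k` are those below `k ∸ 1`, hence the index `suc ∣ p ∣`.
isoClique-iso : (G : Graph n) (p : Subset n) →
  (∀ i j → adj G i j ≡ not (eqF i j) ∧ not (lookup p i) ∧ not (lookup p j)) → G ≅ isoClique n (suc ∣ p ∣)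
isoClique-iso G p formula with π , sorted ← sorting p = record
  { bij      = π
  ; preserve = λ i j → trans (formula i j) (sym (cong₂ _∧_
      (cong not (eqF-injective (π ⟨$⟩ʳ_) (perm-injective π) i j))
      (cong₂ _∧_ (sorted i) (sorted j))))
  }

-- The lower bound for the extremal graph

∣tabulate∣≡∑ : (q : Fin n → Bool) → ∣ Vec.tabulate q ∣ ≡ ∑ (⟦_⟧ ∘ q)
∣tabulate∣≡∑ {zero}  q = refl
∣tabulate∣≡∑ {suc n} q with q zero
... | true  = cong suc (∣tabulate∣≡∑ (q ∘ suc))
... | false = ∣tabulate∣≡∑ (q ∘ suc)

∣below∣ : ∀ n t → t ≤ n → ∣ Vec.tabulate {n = n} (λ i → not (t ≤ᵇ toℕ i)) ∣ ≡ t
∣below∣ zero    zero    _ = refl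
∣below∣ (suc n) zero    _ = ∣below∣ n zero z≤n
∣below∣ (suc n) (suc t) (s≤s t≤n) = cong suc (trans
  (cong ∣_∣ (tabulate-cong {n = n} (λ i → cong not (≤ᵇ-suc t (toℕ i))))) (∣below∣ n t t≤n))

-- Two disjoint families of connected subgraphs are enough: the single vertices of `p` and the
-- subgraphs of the clique on the complement.
F-≥ : (G : Graph n) (p : Subset n) → (∀ {i j} → i ≢ j → i ∉ p → j ∉ p → T (adj G i j)) →
      ∣ p ∣ + binomialSum (n ∸ ∣ p ∣) h ≤ F G
F-≥ {n} G p clique = begin
  ∣ p ∣ + binomialSum (n ∸ ∣ p ∣) h
    ≡⟨ cong₂ (λ a m → a + binomialSum m h) (sym (∑∈-const p _ single)) (sym (∣∁p∣≡n∸∣p∣ p)) ⟩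
  ∑∈ p (λ r → s (⊥ ∪ ⁅ r ⁆)) + binomialSum (∣ ∁ p ∣) h
    ≡⟨ cong (∑∈ p (λ r → s (⊥ ∪ ⁅ r ⁆)) +_) (∑⊆-card (∁ p) h) ⟨
  ∑∈ p (λ r → s (⊥ ∪ ⁅ r ⁆)) + ∑⊆ (∁ p) (h ∘ ∣_∣)
    ≡⟨ cong (∑∈ p (λ r → s (⊥ ∪ ⁅ r ⁆)) +_) (∑⊆-cong (∁ p) inClique) ⟨
  ∑∈ p (λ r → s (⊥ ∪ ⁅ r ⁆)) + ∑⊆ (∁ p) (λ U → s (U ∪ ⊥))
    -- Among the sets meeting `p` in one vertex, only those with empty `U` are kept.
    ≤⟨ +-monoˡ-≤ _ (∑⊆-∅≤ (∁ p) (λ U → ∑∈ p (λ r → s (U ∪ ⁅ r ⁆)))) ⟩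
  ∑⊆ (∁ p) (λ U → ∑∈ p (λ r → s (U ∪ ⁅ r ⁆))) + ∑⊆ (∁ p) (λ U → s (U ∪ ⊥))
    ≡⟨ +-comm _ (∑⊆ (∁ p) (λ U → s (U ∪ ⊥))) ⟩
  ∑⊆ (∁ p) (λ U → s (U ∪ ⊥)) + ∑⊆ (∁ p) (λ U → ∑∈ p (λ r → s (U ∪ ⁅ r ⁆)))
    ≡⟨ ∑⊆-+ (∁ p) _ _ ⟨
  ∑⊆ (∁ p) (λ U → s (U ∪ ⊥) + ∑∈ p (λ r → s (U ∪ ⁅ r ⁆)))
    ≤⟨ ∑⊆-mono (∁ p) (λ U _ → ∑⊆-singletons≤ p (λ A → s (U ∪ A))) ⟩
  ∑⊆ (∁ p) (λ U → ∑⊆ p (λ A → s (U ∪ A)))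
    ≡⟨ trans (F≡∑⊆ G) (∑⊆-∪ p s) ⟨
  F G ∎
  where
  open ≤-Reasoning
  s : Subset n → ℕ
  s V = spanning G (lookup V)

  inClique : ∀ U → U ⊆ ∁ p → s (U ∪ ⊥) ≡ h ∣ U ∣
  inClique U U⊆ = trans (cong s (∪-identityʳ U)) (spanning-complete G U
    (λ i∈ j∈ i≢j → clique i≢j (x∈∁p⇒x∉p (U⊆ i∈)) (x∈∁p⇒x∉p (U⊆ j∈))))

  single : ∀ {r} → r ∈ p → s (⊥ ∪ ⁅ r ⁆) ≡ 1
  single {r} _ = trans (cong s (∪-identityˡ ⁅ r ⁆)) (trans (spanning-complete G ⁅ r ⁆
    (λ i∈ j∈ i≢j → ⊥-elim (i≢j (trans (x∈⁅y⁆⇒x≡y r i∈) (sym (x∈⁅y⁆⇒x≡y r j∈))))))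
    (cong h (∣⁅x⁆∣≡1 r)))

iso⇒F-≥ : ∀ {k} → 1 ≤ k → k ≤ n → (G : Graph n) → G ≅ isoClique n k → coreBound n k ≤ F G
iso⇒F-≥ {n} {suc t} _ k≤n G iso = begin
  coreBound n (suc t)                       ≡⟨ coreBound≡ n (suc t) ⟩
  -- With `t` = k - 1 isolated vertices, the clique has n - t = n - k + 1 vertices.
  t + binomialSum (suc (n ∸ suc t)) h       ≡⟨ cong (λ m → t + binomialSum m h) (sym (+-∸-assoc 1 k≤n)) ⟩
  t + binomialSum (n ∸ t) h                 ≡⟨ cong (λ a → a + binomialSum (n ∸ a) h) (sym ∣p∣≡t) ⟩
  ∣ p ∣ + binomialSum (n ∸ ∣ p ∣) h         ≤⟨ F-≥ G p clique ⟩
  F G                                       ∎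
  where
  open ≤-Reasoning
  π = _≅_.bij iso
  low : Fin n → Bool
  low i = not (t ≤ᵇ toℕ i)
  p = Vec.tabulate (λ i → low (π ⟨$⟩ʳ i))
  ∣p∣≡t : ∣ p ∣ ≡ t
  -- Written as a sum, the size of `p` is invariant under `π`, so it is the number of positions
  -- below `t`.
  ∣p∣≡t = trans (∣tabulate∣≡∑ (λ i → low (π ⟨$⟩ʳ i))) (trans (sym (sum-permute (⟦_⟧ ∘ low) π))
    (trans (sym (∣tabulate∣≡∑ low)) (∣below∣ n t (<⇒≤ k≤n))))
  high : ∀ {i} → i ∉ p → T (t ≤ᵇ toℕ (π ⟨$⟩ʳ i))
  high {i} i∉p with t ≤ᵇ toℕ (π ⟨$⟩ʳ i) in eq
  ... | true  = _
  ... | false = i∉p (∈-tabulate⁺ (subst (T ∘ not) (sym eq) _))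
  clique : ∀ {i j} → i ≢ j → i ∉ p → j ∉ p → T (adj G i j)
  clique {i} {j} i≢j i∉ j∉ = subst T (sym (_≅_.preserve iso i j))
    (from (T-∧ {not (eqF (π ⟨$⟩ʳ i) (π ⟨$⟩ʳ j))}) (fromWitnessFalse (i≢j ∘ perm-injective π) ,
      from (T-∧ {t ≤ᵇ toℕ (π ⟨$⟩ʳ i)}) (high i∉ , high j∉)))

theorem2p3 : (n k : ℕ) → 1 ≤ k → k ≤ n → (G : Graph n) → components G ≡ k →
    (F G ≤ (k ∸ 1) + sum1 (n ∸ k + 1) (λ i → ((n ∸ k + 1) C i) * h i))
    × ((F G ≡ (k ∸ 1) + sum1 (n ∸ k + 1) (λ i → ((n ∸ k + 1) C i) * h i))
    ⇔ (G ≅ isoClique n k))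
-- Matching on `refl` turns `k` into `∣ roots G ∣`, so `1≤k` says that there is a root.
theorem2p3 n k 1≤k k≤n G comp≡k with refl ← trans (sym (components≡∣roots∣ G)) comp≡k =
  F-≤ G 1≤k , mk⇔ extremal (λ iso → ≤-antisym (F-≤ G 1≤k) (iso⇒F-≥ 1≤k k≤n G iso))
  where
  extremal : F G ≡ coreBound n k → G ≅ isoClique n k
  -- The isolated vertices are the roots other than `ρ`, so one more than their number is `k`.
  extremal F≡ = subst (λ k → G ≅ isoClique n k) (sym (∣p∣≡1+∣p-x∣ (roots G) (proj₁ (proj₂ centre))))
    (isoClique-iso G isolated adj-formula)
    where open Extremal G 1≤k (nonroots-adj G 1≤k F≡) (nonroot-adj-root G 1≤k F≡)
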